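{- The category of $\ominus$-algebras and homomorphisms is dually equivalent to the category of $\ominus$-spaces and morphisms of $\ominus$-spaces.
   Context: **$\ominus$-algebras.** A $\ominus$-algebra $(A,\ominus)$ is a bounded distributive lattice $A$ with a binary operation $\ominus$ such that for all $a,b,c\in A$: (1) $(a\wedge b)\ominus c=(a\ominus c)\wedge(b\ominus c)$, $(a\vee b)\ominus c=(a\ominus c)\vee(b\ominus c)$, $a\ominus(b\wedge c)=(a\ominus b)\vee(a\ominus c)$, $a\ominus(b\vee c)=(a\ominus b)\wedge(a\ominus c)$; (2) $0\ominus a=0$ and $a\ominus 1=0$; (3) $a\ominus 0=a$. Homomorphisms of $\ominus$-algebras are bounded lattice homomorphisms preserving $\ominus$. **Priestley spaces.** A Priestley space is a compact ordered topological space $X$ such that whenever $x\not\leq y$ there is a clopen down-set $U$ with $y\in U$, $x\notin U$. If $\tau$ is the topology of $X$, then $\tau^\uparrow$ is the topology of $\tau$-open up-sets and $\tau^\downarrow$ is the topology of $\tau$-open down-sets. **$\ominus$-spaces.** A $\ominus$-space is a tuple $(X,i,+,\star)$ where: (1) $X$ is a Priestley space; (2) $i\colon X\to X$ is continuous and order-reversing; (3) $+$ is a partial binary function on $X$ with $\mathrm{dom}(+)=\{(x,y)\in X^2\mid y\leq i(x)\}$, which is upper continuous: continuous from $\mathrm{dom}(+)$, with the subspace topology of $(X,\tau^\uparrow)\times(X,\tau^\uparrow)$, to $(X,\tau^\uparrow)$; (4) $\star$ is a partial binary function on $X$ with $\mathrm{dom}(\star)=\{(x,y)\in X^2\mid i(x)\nleq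 y\}$, which is lower continuous: continuous from $\mathrm{dom}(\star)$, with the subspace topology of $(X,\tau^\downarrow)\times(X,\tau^\downarrow)$, to $(X,\tau^\downarrow)$; (5) $+$ and $\star$ are order-preserving in both coordinates (on their domains); (6) for any $(x,y)\in\mathrm{dom}(\star)$, $x\star y=\inf\{x+w\mid (x,w)\in\mathrm{dom}(+)\text{ and }w\nleq y\}$ (infimum in $X$); (7) for any $x\in X$, the map $L_x\colon w\mapsto x+w$ is a map ${\downarrow}i(x)\to{\uparrow}x$ (in particular $x\leq x+w$) with totally ordered image, and it has an upper adjoint $L_x^\sharp\colon{\uparrow}x\to{\downarrow}i(x)$, i.e. $L_x(w)\leq z\iff w\leq L_x^\sharp(z)$ for all $w\in{\downarrow}i(x)$, $z\in{\uparrow}x$. **Morphisms.** A morphism from a $\ominus$-space $(X_1,i_1,+_1,\star_1)$ to a $\ominus$-space $(X_2,i_2,+_2,\star_2)$ is a continuous order-preserving function $f\colon X_1\to X_2$ such that: (1) $f(i_1(x))=i_2(f(x))$ for all $x\in X_1$; (2) for all $x,y\in X_1$, if $(x,y)\in\mathrm{dom}(+_1)$ then $f(x)+_2f(y)\leq f(x+_1y)$; (3) for all $x\in X_1$, $z\in X_2$, if $(f(x),z)\in\mathrm{dom}(+_2)$ then there exists $w'\in X_1$ with $(x,w')\in\mathrm{dom}(+_1)$, $z\leq f(w')$, and $f(x+_1w')=f(x)+_2z$. -}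

module Defs where

open import Level using (Level; suc; _⊔_)
open import Algebra.Core using (Op₁; Op₂)
open import Algebra.Definitions using (Identity; Congruent₂)
open import Algebra.Lattice.Bundles using (RawLattice)
open import Algebra.Lattice.Structures using (IsDistributiveLattice)
open import Algebra.Lattice.Morphism.Structures using (IsLatticeHomomorphism)
import Algebra.Lattice.Morphism.Construct.Composition as LatticeComp
import Algebra.Lattice.Morphism.Construct.Identity as LatticeId
open import Data.List.Base using (List)
open import Data.List.Relation.Unary.Any using (Any)
open import Data.Product using (Σ; ∃; ∃-syntax; Σ-syntax; _×_; _,_; proj₁; proj₂)
open import Data.Product.Relation.Binary.Pointwise.NonDependent using (×-setoid)
open import Data.Sum.Base using (_⊎_)
open import Data.Unit.Polymorphic.Base using (⊤)
open import Function.Base using (_∘′_) renaming (id to idᶠ)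
open import Function.Bundles using (_⇔_)
open import Relation.Binary.Bundles using (Setoid; Poset)
open import Relation.Binary.Core using (Rel)
open import Relation.Binary.Definitions using (_Respects_)
open import Relation.Binary.Structures using (IsEquivalence)
import Relation.Binary.Construct.On as On
open import Relation.Nullary.Negation.Core using (¬_)
open import Relation.Unary using (Pred; _∈_; _∉_; _⊆_; _≐_; _∩_; ∁; ⋃; _⊢_; _⟨×⟩_)

record Category (o h e : Level) : Set (suc (o ⊔ h ⊔ e)) where
  infix  4 _≈_ _⇒_
  infixr 9 _∘_
  field
    Obj       : Set o
    _⇒_       : Rel Obj h
    _≈_       : ∀ {A B} → Rel (A ⇒ B) e
    id        : ∀ {A} → A ⇒ A
    _∘_       : ∀ {A B C} → B ⇒ C → A ⇒ B → A ⇒ C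
    equiv     : ∀ {A B} → IsEquivalence (_≈_ {A} {B})
    ∘-resp-≈  : ∀ {A B C} {f f′ : B ⇒ C} {g g′ : A ⇒ B} →
                f ≈ f′ → g ≈ g′ → f ∘ g ≈ f′ ∘ g′
    identityˡ : ∀ {A B} {f : A ⇒ B} → id ∘ f ≈ f
    identityʳ : ∀ {A B} {f : A ⇒ B} → f ∘ id ≈ f
    assoc     : ∀ {A B C D} {f : A ⇒ B} {g : B ⇒ C} {h : C ⇒ D} →
                (h ∘ g) ∘ f ≈ h ∘ (g ∘ f)

op : ∀ {o h e} → Category o h e → Category o h e
op C = record
  { Obj       = C.Obj
  ; _⇒_       = λ A B → B C.⇒ A
  ; _≈_       = C._≈_
  ; id        = C.id
  ; _∘_       = λ f g → g C.∘ f
  ; equiv     = C.equiv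
  ; ∘-resp-≈  = λ p q → C.∘-resp-≈ q p
  ; identityˡ = C.identityʳ
  ; identityʳ = C.identityˡ
  ; assoc     = IsEquivalence.sym C.equiv C.assoc
  } where module C = Category C

private
  variable
    o h e o′ h′ e′ o″ h″ e″ : Level

record Functor (C : Category o h e) (D : Category o′ h′ e′)
               : Set (o ⊔ h ⊔ e ⊔ o′ ⊔ h′ ⊔ e′) where
  private
    module C = Category C
    module D = Category D
  field
    F₀           : C.Obj → D.Obj
    F₁           : ∀ {A B} → A C.⇒ B → F₀ A D.⇒ F₀ B
    F-resp-≈     : ∀ {A B} {f g : A C.⇒ B} → f C.≈ g → F₁ f D.≈ F₁ g
    identity     : ∀ {A} → F₁ (C.id {A}) D.≈ D.id
    homomorphism : ∀ {X Y Z} {f : X C.⇒ Y} {g : Y C.⇒ Z} →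
                   F₁ (g C.∘ f) D.≈ F₁ g D.∘ F₁ f

idF : (C : Category o h e) → Functor C C
idF C = record
  { F₀           = λ A → A
  ; F₁           = λ f → f
  ; F-resp-≈     = λ p → p
  ; identity     = IsEquivalence.refl (Category.equiv C)
  ; homomorphism = IsEquivalence.refl (Category.equiv C)
  }

infixr 9 _∘F_

_∘F_ : {C : Category o h e} {D : Category o′ h′ e′} {E : Category o″ h″ e″} →
       Functor D E → Functor C D → Functor C E
_∘F_ {E = E} G F = record
  { F₀           = λ A → G.F₀ (F.F₀ A)
  ; F₁           = λ f → G.F₁ (F.F₁ f)
  ; F-resp-≈     = λ p → G.F-resp-≈ (F.F-resp-≈ p)
  ; identity     = IsEquivalence.trans (Category.equiv E)
                     (G.F-resp-≈ F.identity) G.identity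
  ; homomorphism = IsEquivalence.trans (Category.equiv E)
                     (G.F-resp-≈ F.homomorphism) G.homomorphism
  } where
    module G = Functor G
    module F = Functor F

record NaturalIsomorphism {C : Category o h e} {D : Category o′ h′ e′}
                          (F G : Functor C D)
                          : Set (o ⊔ h ⊔ e ⊔ o′ ⊔ h′ ⊔ e′) where
  private
    module C = Category C
    module F = Functor F
    module G = Functor G
  open Category D
  field
    η       : ∀ A → F.F₀ A ⇒ G.F₀ A
    η⁻¹     : ∀ A → G.F₀ A ⇒ F.F₀ A
    isoˡ    : ∀ A → η⁻¹ A ∘ η A ≈ id
    isoʳ    : ∀ A → η A ∘ η⁻¹ A ≈ id
    natural : ∀ {A B} (f : A C.⇒ B) → η B ∘ F.F₁ f ≈ G.F₁ f ∘ η A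

record Equivalence (C : Category o h e) (D : Category o′ h′ e′)
                   : Set (o ⊔ h ⊔ e ⊔ o′ ⊔ h′ ⊔ e′) where
  field
    F    : Functor C D
    G    : Functor D C
    GF≅1 : NaturalIsomorphism (G ∘F F) (idF C)
    FG≅1 : NaturalIsomorphism (F ∘F G) (idF D)

DualEquivalence : Category o h e → Category o′ h′ e′ →
                  Set (o ⊔ h ⊔ e ⊔ o′ ⊔ h′ ⊔ e′)
DualEquivalence C D = Equivalence (op C) D

private
  variable
    ℓ : Level

record ⊖-Algebra (ℓ : Level) : Set (suc ℓ) where
  infix  4 _≈_
  infixl 8 _⊖_
  infixr 7 _∧_
  infixr 6 _∨_
  field
    Carrier : Set ℓ
    _≈_     : Rel Carrier ℓ
    _∨_ _∧_ : Op₂ Carrier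
    0# 1#   : Carrier
    _⊖_     : Op₂ Carrier

    isDistributiveLattice : IsDistributiveLattice _≈_ _∨_ _∧_
    ∨-identity : Identity _≈_ 0# _∨_
    ∧-identity : Identity _≈_ 1# _∧_

    ⊖-cong : Congruent₂ _≈_ _⊖_
    ∧-⊖    : ∀ a b c → (a ∧ b) ⊖ c ≈ (a ⊖ c) ∧ (b ⊖ c)
    ∨-⊖    : ∀ a b c → (a ∨ b) ⊖ c ≈ (a ⊖ c) ∨ (b ⊖ c)
    ⊖-∧    : ∀ a b c → a ⊖ (b ∧ c) ≈ (a ⊖ b) ∨ (a ⊖ c)
    ⊖-∨    : ∀ a b c → a ⊖ (b ∨ c) ≈ (a ⊖ b) ∧ (a ⊖ c)
    0-⊖    : ∀ a → 0# ⊖ a ≈ 0#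
    ⊖-1    : ∀ a → a ⊖ 1# ≈ 0#
    ⊖-0    : ∀ a → a ⊖ 0# ≈ a

  open IsDistributiveLattice isDistributiveLattice public

  rawLattice : RawLattice ℓ ℓ
  rawLattice = record { _≈_ = _≈_ ; _∧_ = _∧_ ; _∨_ = _∨_ }

record ⊖-Hom (A B : ⊖-Algebra ℓ) : Set ℓ where
  private
    module A = ⊖-Algebra A
    module B = ⊖-Algebra B
  field
    ⟦_⟧ : A.Carrier → B.Carrier
    isLatticeHomomorphism : IsLatticeHomomorphism A.rawLattice B.rawLattice ⟦_⟧
    0-homo : ⟦ A.0# ⟧ B.≈ B.0#
    1-homo : ⟦ A.1# ⟧ B.≈ B.1#
    ⊖-homo : ∀ a b → ⟦ a A.⊖ b ⟧ B.≈ ⟦ a ⟧ B.⊖ ⟦ b ⟧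

  open IsLatticeHomomorphism isLatticeHomomorphism public
    using (⟦⟧-cong; ∧-homo; ∨-homo)

⊖-Alg : (ℓ : Level) → Category (suc ℓ) ℓ ℓ
⊖-Alg ℓ = record
  { Obj       = ⊖-Algebra ℓ
  ; _⇒_       = ⊖-Hom
  ; _≈_       = λ {_} {B} f g → ∀ a → ⊖-Algebra._≈_ B (⊖-Hom.⟦_⟧ f a) (⊖-Hom.⟦_⟧ g a)
  ; id        = λ {A} → idHom A
  ; _∘_       = compHom
  ; equiv     = λ {_} {B} → record
    { refl  = λ _ → ⊖-Algebra.refl B
    ; sym   = λ p a → ⊖-Algebra.sym B (p a)
    ; trans = λ p q a → ⊖-Algebra.trans B (p a) (q a)
    }
  ; ∘-resp-≈  = λ {_} {_} {C} {_} {f′} {g} p q a →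
                ⊖-Algebra.trans C (p (⊖-Hom.⟦_⟧ g a)) (⊖-Hom.⟦⟧-cong f′ (q a))
  ; identityˡ = λ {_} {B} _ → ⊖-Algebra.refl B
  ; identityʳ = λ {_} {B} _ → ⊖-Algebra.refl B
  ; assoc     = λ {_} {_} {_} {D} _ → ⊖-Algebra.refl D
  }
  where
  idHom : (A : ⊖-Algebra ℓ) → ⊖-Hom A A
  idHom A = record
    { ⟦_⟧ = idᶠ
    ; isLatticeHomomorphism = LatticeId.isLatticeHomomorphism A.rawLattice A.refl
    ; 0-homo = A.refl
    ; 1-homo = A.refl
    ; ⊖-homo = λ _ _ → A.refl
    } where module A = ⊖-Algebra A

  compHom : {A B C : ⊖-Algebra ℓ} → ⊖-Hom B C → ⊖-Hom A B → ⊖-Hom A C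
  compHom {C = C} g f = record
    { ⟦_⟧ = g.⟦_⟧ ∘′ f.⟦_⟧
    ; isLatticeHomomorphism = LatticeComp.isLatticeHomomorphism C.trans
                                f.isLatticeHomomorphism g.isLatticeHomomorphism
    ; 0-homo = C.trans (g.⟦⟧-cong f.0-homo) g.0-homo
    ; 1-homo = C.trans (g.⟦⟧-cong f.1-homo) g.1-homo
    ; ⊖-homo = λ a b → C.trans (g.⟦⟧-cong (f.⊖-homo a b)) (g.⊖-homo _ _)
    } where
      module C = ⊖-Algebra C
      module g = ⊖-Hom g
      module f = ⊖-Hom f

-- Points form a setoid at level ℓ and subsets are predicates at the same
-- level ℓ.  `Open` lives one level up so that the product and subspace
-- topologies, whose open sets are defined by quantifying over open sets, are
-- again of this form.  The empty set is open as the union over the empty type.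

record Topology (S : Setoid ℓ ℓ) : Set (suc (suc ℓ)) where
  open Setoid S
  field
    Open   : Pred (Pred Carrier ℓ) (suc ℓ)
    resp-≈ : ∀ {U} → Open U → U Respects _≈_
    resp-≐ : ∀ {U V} → U ≐ V → Open U → Open V
    whole  : Open (λ _ → ⊤)
    inter  : ∀ {U V} → Open U → Open V → Open (U ∩ V)
    union  : ∀ {I : Set ℓ} {U : I → Pred Carrier ℓ} →
             (∀ i → Open (U i)) → Open (⋃ I U)

  Clopen : Pred (Pred Carrier ℓ) (suc ℓ)
  Clopen U = Open U × Open (∁ U)

  Compact : Set (suc ℓ)
  Compact = {I : Set ℓ} (U : I → Pred Carrier ℓ) → (∀ i → Open (U i)) →
            (∀ x → ∃[ i ] x ∈ U i) →
            Σ[ is ∈ List I ] (∀ x → Any (λ i → x ∈ U i) is)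

Continuous : {S T : Setoid ℓ ℓ} → Topology S → Topology T →
             (Setoid.Carrier S → Setoid.Carrier T) → Set (suc ℓ)
Continuous σ τ f = ∀ {U} → Topology.Open τ U → Topology.Open σ (f ⊢ U)

productTopology : {S T : Setoid ℓ ℓ} → Topology S → Topology T →
                  Topology (×-setoid S T)
productTopology σ τ = record
  { Open   = λ W → ∀ p → p ∈ W →
             ∃[ U ] ∃[ V ] (σ.Open U × τ.Open V × p ∈ (U ⟨×⟩ V) × (U ⟨×⟩ V) ⊆ W)
  ; resp-≈ = λ oW (x≈ , y≈) p∈W →
      let (U , V , oU , oV , (x∈U , y∈V) , UV⊆W) = oW _ p∈W
      in UV⊆W (σ.resp-≈ oU x≈ x∈U , τ.resp-≈ oV y≈ y∈V)
  ; resp-≐ = λ (W⊆W′ , W′⊆W) oW p p∈W′ →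
      let (U , V , oU , oV , p∈UV , UV⊆W) = oW p (W′⊆W p∈W′)
      in U , V , oU , oV , p∈UV , λ q → W⊆W′ (UV⊆W q)
  ; whole  = λ _ _ → (λ _ → ⊤) , (λ _ → ⊤) , σ.whole , τ.whole , _ , _
  ; inter  = λ oW oW′ p (p∈W , p∈W′) →
      let (U  , V  , oU  , oV  , (x∈U  , y∈V ) , UV⊆W ) = oW  p p∈W
          (U′ , V′ , oU′ , oV′ , (x∈U′ , y∈V′) , UV⊆W′) = oW′ p p∈W′
      in U ∩ U′ , V ∩ V′ , σ.inter oU oU′ , τ.inter oV oV′ , ((x∈U , x∈U′) , (y∈V , y∈V′)) ,
         λ ((a , a′) , (b , b′)) → UV⊆W (a , b) , UV⊆W′ (a′ , b′)
  ; union  = λ oW p (i , p∈Wi) →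
      let (U , V , oU , oV , p∈UV , UV⊆W) = oW i p p∈Wi
      in U , V , oU , oV , p∈UV , λ q → i , UV⊆W q
  }
  where
  module σ = Topology σ
  module τ = Topology τ

subSetoid : (S : Setoid ℓ ℓ) → Pred (Setoid.Carrier S) ℓ → Setoid ℓ ℓ
subSetoid S P = On.setoid S (proj₁ {B = P})

subspaceTopology : {S : Setoid ℓ ℓ} → Topology S → (P : Pred (Setoid.Carrier S) ℓ) →
                   Topology (subSetoid S P)
subspaceTopology {S = S} τ P = record
  { Open   = λ W → ∃[ U ] (Open U × W ≐ (proj₁ ⊢ U))
  ; resp-≈ = λ (U , oU , W⊆U , U⊆W) x≈ x∈W → U⊆W (resp-≈ oU x≈ (W⊆U x∈W))
  ; resp-≐ = λ (W⊆W′ , W′⊆W) (U , oU , W⊆U , U⊆W) →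
      U , oU , (λ w → W⊆U (W′⊆W w)) , λ u → W⊆W′ (U⊆W u)
  ; whole  = _ , whole , _ , _
  ; inter  = λ (U , oU , W⊆U , U⊆W) (U′ , oU′ , W′⊆U′ , U′⊆W′) →
      U ∩ U′ , inter oU oU′ , (λ (w , w′) → W⊆U w , W′⊆U′ w′) , λ (u , u′) → U⊆W u , U′⊆W′ u′
  ; union  = λ {I} o → ⋃ I (λ i → proj₁ (o i)) , union (λ i → proj₁ (proj₂ (o i))) ,
      (λ (i , w) → i , proj₁ (proj₂ (proj₂ (o i))) w) ,
      λ (i , u) → i , proj₂ (proj₂ (proj₂ (o i))) u
  }
  where open Topology τ

module _ (P : Poset ℓ ℓ ℓ) where
  open Poset P

  UpSet DownSet : Pred (Pred Carrier ℓ) ℓ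
  UpSet   U = ∀ {x y} → x ≤ y → x ∈ U → y ∈ U
  DownSet U = ∀ {x y} → x ≤ y → y ∈ U → x ∈ U

  ↓ ↑ : Carrier → Set ℓ
  ↓ a = ∃[ x ] x ≤ a
  ↑ a = ∃[ x ] a ≤ x

  IsInfimum : Pred Carrier ℓ → Carrier → Set ℓ
  IsInfimum S z = (∀ {u} → u ∈ S → z ≤ u) ×
                  (∀ v → (∀ {u} → u ∈ S → v ≤ u) → v ≤ z)

  upTopology downTopology : Topology Eq.setoid → Topology Eq.setoid
  upTopology τ = record
    { Open   = λ U → Open U × UpSet U
    ; resp-≈ = λ (oU , _) → resp-≈ oU
    ; resp-≐ = λ (U⊆V , V⊆U) (oU , up) → resp-≐ (U⊆V , V⊆U) oU , λ x≤y x∈V → U⊆V (up x≤y (V⊆U x∈V))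
    ; whole  = whole , _
    ; inter  = λ (oU , up) (oV , up′) → inter oU oV , λ x≤y (u , v) → up x≤y u , up′ x≤y v
    ; union  = λ o → union (λ i → proj₁ (o i)) , λ x≤y (i , u) → i , proj₂ (o i) x≤y u
    }
    where open Topology τ
  downTopology τ = record
    { Open   = λ U → Open U × DownSet U
    ; resp-≈ = λ (oU , _) → resp-≈ oU
    ; resp-≐ = λ (U⊆V , V⊆U) (oU , dn) → resp-≐ (U⊆V , V⊆U) oU , λ x≤y y∈V → U⊆V (dn x≤y (V⊆U y∈V))
    ; whole  = whole , _
    ; inter  = λ (oU , dn) (oV , dn′) → inter oU oV , λ x≤y (u , v) → dn x≤y u , dn′ x≤y v
    ; union  = λ o → union (λ i → proj₁ (o i)) , λ x≤y (i , u) → i , proj₂ (o i) x≤y u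
    }
    where open Topology τ

record PriestleySpace (ℓ : Level) : Set (suc (suc ℓ)) where
  field
    poset    : Poset ℓ ℓ ℓ
    topology : Topology (Poset.Eq.setoid poset)

  open Poset poset public
  open Topology topology public using (Open; Clopen; Compact)

  τ↑ : Topology (Poset.Eq.setoid poset)
  τ↑ = upTopology poset topology

  τ↓ : Topology (Poset.Eq.setoid poset)
  τ↓ = downTopology poset topology

  field
    compact    : Compact
    separation : ∀ {x y} → ¬ (x ≤ y) →
                 ∃[ U ] (Clopen U × DownSet poset U × y ∈ U × x ∉ U)

-- A partial binary function is a function on the subset of pairs where it is
-- defined.  Well-definedness with respect to ≈, and independence of the proof
-- of membership in the domain, follow from monotonicity and antisymmetry.

record ⊖-Space (ℓ : Level) : Set (suc (suc ℓ)) where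
  field
    priestleySpace : PriestleySpace ℓ

  open PriestleySpace priestleySpace public

  field
    i            : Op₁ Carrier
    i-continuous : Continuous topology topology i
    i-antitone   : ∀ {x y} → x ≤ y → i y ≤ i x

  dom+ : Pred (Carrier × Carrier) ℓ
  dom+ = λ (x , y) → y ≤ i x

  dom⋆ : Pred (Carrier × Carrier) ℓ
  dom⋆ = λ (x , y) → ¬ (i x ≤ y)

  field
    plus : Σ (Carrier × Carrier) dom+ → Carrier
    star : Σ (Carrier × Carrier) dom⋆ → Carrier

  _+_[_] : ∀ x y → (x , y) ∈ dom+ → Carrier
  x + y [ p ] = plus ((x , y) , p)

  _⋆_[_] : ∀ x y → (x , y) ∈ dom⋆ → Carrier
  x ⋆ y [ p ] = star ((x , y) , p)

  field
    +-upperContinuous :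
      Continuous (subspaceTopology (productTopology τ↑ τ↑) dom+) τ↑ plus
    ⋆-lowerContinuous :
      Continuous (subspaceTopology (productTopology τ↓ τ↓) dom⋆) τ↓ star

    +-monoˡ : ∀ {x x′ y} (p : (x , y) ∈ dom+) (q : (x′ , y) ∈ dom+) →
              x ≤ x′ → x + y [ p ] ≤ x′ + y [ q ]
    +-monoʳ : ∀ {x y y′} (p : (x , y) ∈ dom+) (q : (x , y′) ∈ dom+) →
              y ≤ y′ → x + y [ p ] ≤ x + y′ [ q ]
    ⋆-monoˡ : ∀ {x x′ y} (p : (x , y) ∈ dom⋆) (q : (x′ , y) ∈ dom⋆) →
              x ≤ x′ → x ⋆ y [ p ] ≤ x′ ⋆ y [ q ]
    ⋆-monoʳ : ∀ {x y y′} (p : (x , y) ∈ dom⋆) (q : (x , y′) ∈ dom⋆) →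
              y ≤ y′ → x ⋆ y [ p ] ≤ x ⋆ y′ [ q ]

    ⋆-infimum : ∀ {x y} (p : (x , y) ∈ dom⋆) →
      IsInfimum poset
        (λ u → ∃[ w ] Σ[ q ∈ (x , w) ∈ dom+ ] (¬ (w ≤ y) × u ≈ x + w [ q ]))
        (x ⋆ y [ p ])

    +-increasing : ∀ {x w} (p : (x , w) ∈ dom+) → x ≤ x + w [ p ]

  L : ∀ x → ↓ poset (i x) → ↑ poset x
  L x = λ (w , p) → x + w [ p ] , +-increasing p

  field
    L-chain   : ∀ x v w → proj₁ (L x v) ≤ proj₁ (L x w) ⊎ proj₁ (L x w) ≤ proj₁ (L x v)
    L-adjoint : ∀ x → Σ[ L♯ ∈ (↑ poset x → ↓ poset (i x)) ]
                (∀ w z → proj₁ (L x w) ≤ proj₁ z ⇔ proj₁ w ≤ proj₁ (L♯ z))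

record ⊖-Map (X Y : ⊖-Space ℓ) : Set (suc ℓ) where
  private
    module X = ⊖-Space X
    module Y = ⊖-Space Y
  field
    ⟦_⟧        : X.Carrier → Y.Carrier
    continuous : Continuous X.topology Y.topology ⟦_⟧
    mono       : ∀ {x y} → x X.≤ y → ⟦ x ⟧ Y.≤ ⟦ y ⟧
    i-homo     : ∀ x → ⟦ X.i x ⟧ Y.≈ Y.i ⟦ x ⟧

  -- `q` always exists, by `mono` and `i-homo`.
  field
    +-forth : ∀ x y (p : (x , y) ∈ X.dom+) (q : (⟦ x ⟧ , ⟦ y ⟧) ∈ Y.dom+) →
              ⟦ x ⟧ Y.+ ⟦ y ⟧ [ q ] Y.≤ ⟦ x X.+ y [ p ] ⟧
    +-back  : ∀ x z (q : (⟦ x ⟧ , z) ∈ Y.dom+) →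
              ∃[ w ] Σ[ p ∈ (x , w) ∈ X.dom+ ]
                (z Y.≤ ⟦ w ⟧ × ⟦ x X.+ w [ p ] ⟧ Y.≈ ⟦ x ⟧ Y.+ z [ q ])

  cong : ∀ {x y} → x X.≈ y → ⟦ x ⟧ Y.≈ ⟦ y ⟧
  cong x≈y = Y.antisym (mono (X.reflexive x≈y)) (mono (X.reflexive (X.Eq.sym x≈y)))

⊖-Sp : (ℓ : Level) → Category (suc (suc ℓ)) (suc ℓ) ℓ
⊖-Sp ℓ = record
  { Obj       = ⊖-Space ℓ
  ; _⇒_       = ⊖-Map
  ; _≈_       = λ {_} {Y} f g → ∀ x → ⊖-Space._≈_ Y (⊖-Map.⟦_⟧ f x) (⊖-Map.⟦_⟧ g x)
  ; id        = λ {X} → idMap X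
  ; _∘_       = compMap
  ; equiv     = λ {_} {Y} → record
    { refl  = λ _ → ⊖-Space.Eq.refl Y
    ; sym   = λ p x → ⊖-Space.Eq.sym Y (p x)
    ; trans = λ p q x → ⊖-Space.Eq.trans Y (p x) (q x)
    }
  ; ∘-resp-≈  = λ {_} {_} {Z} {_} {f′} {g} p q x →
                ⊖-Space.Eq.trans Z (p (⊖-Map.⟦_⟧ g x)) (⊖-Map.cong f′ (q x))
  ; identityˡ = λ {_} {Y} _ → ⊖-Space.Eq.refl Y
  ; identityʳ = λ {_} {Y} _ → ⊖-Space.Eq.refl Y
  ; assoc     = λ {_} {_} {_} {Z} _ → ⊖-Space.Eq.refl Z
  }
  where
  idMap : (X : ⊖-Space ℓ) → ⊖-Map X X
  idMap X = record
    { ⟦_⟧        = idᶠ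
    ; continuous = idᶠ
    ; mono       = idᶠ
    ; i-homo     = λ _ → X.Eq.refl
    ; +-forth    = λ x y p q → X.+-monoʳ q p X.refl
    ; +-back     = λ x z q → z , q , X.refl , X.Eq.refl
    } where module X = ⊖-Space X

  compMap : {X Y Z : ⊖-Space ℓ} → ⊖-Map Y Z → ⊖-Map X Y → ⊖-Map X Z
  compMap {X} {Y} {Z} g f = record
    { ⟦_⟧        = g.⟦_⟧ ∘′ f.⟦_⟧
    ; continuous = λ oU → f.continuous (g.continuous oU)
    ; mono       = λ x≤y → g.mono (f.mono x≤y)
    ; i-homo     = λ x → Z.Eq.trans (g.cong (f.i-homo x)) (g.i-homo f.⟦ x ⟧)
    ; +-forth    = λ x y p q →
        let r = Y.trans (f.mono p) (Y.reflexive (f.i-homo x))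
        in Z.trans (g.+-forth f.⟦ x ⟧ f.⟦ y ⟧ r q) (g.mono (f.+-forth x y p r))
    ; +-back     = λ x z q →
        let (v , r , z≤gv , eq)  = g.+-back f.⟦ x ⟧ z q
            (w , p , v≤fw , eq′) = f.+-back x v r
        in w , p , Z.trans z≤gv (g.mono v≤fw) , Z.Eq.trans (g.cong eq′) eq
    } where
      module Y = ⊖-Space Y
      module Z = ⊖-Space Z
      module g = ⊖-Map g
      module f = ⊖-Map f

{-# OPTIONS --safe #-}

-- The points of the dual space of A are the prime filters of A, ordered by
-- reverse inclusion, with
--   i x     = {a ∣ 1 ⊖ a ∉ x}
--   x + y   = {a ∣ a ⊖ b ∈ x for all b ∉ y}
--   x ⋆ y   = {a ∣ a ⊖ b ∈ x for some b ∈ y}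
--   L♯ₓ z   = {b ∣ a ⊖ b ∉ x for some a ∈ z}.
-- The image of Lₓ is a chain because the prime filters {a ∣ a ⊖ b ∈ x}, for
-- varying b, are pairwise comparable.  Conversely, a ⊖-space gives the lattice of
-- its clopen down-sets with
--   U ⊖ V = {x ∣ x + w ∈ U for some w ≤ i x with w ∉ V}
--         = {x ∈ U ∣ i x ≰ y and x ⋆ y ∈ U for all y ∈ V}.
-- Compactness of the complement of V and upper continuity of + make the first set
-- closed; compactness of V and lower continuity of ⋆ make the second one open.
-- They agree because x ⋆ y is the
-- infimum of a chain of values x + w, and x + L♯ₓ z ≤ z combines finitely many
-- choices of w into one.
module Submission where

open import Defs
open import Level using (Level; Lift; lift; lower; suc)
open import Axiom.ExcludedMiddle using (ExcludedMiddle)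
open import Axiom.Extensionality.Propositional using (Extensionality)
open import Algebra.Lattice.Bundles using (Lattice)
open import Algebra.Lattice.Morphism.Structures using (IsLatticeMonomorphism)
import Algebra.Lattice.Morphism.LatticeMonomorphism as LatticeMonomorphism
import Algebra.Lattice.Properties.Lattice as LatticeProperties
open import Algebra.Lattice.Structures using (IsDistributiveLattice)
open import Data.Bool.Base using (Bool; true; false)
open import Data.Empty using (⊥-elim)
import Data.Empty.Polymorphic as Empty
open import Data.List.Base using (List; []; _∷_; _++_; map; foldr; catMaybes)
open import Data.List.Membership.Propositional using () renaming (_∈_ to _∈ₗ_)
open import Data.List.Relation.Binary.Subset.Propositional using () renaming (_⊆_ to _⊆ₗ_)
open import Data.List.Relation.Binary.Subset.Propositional.Properties
  using (xs⊆xs++ys; xs⊆ys++xs; xs⊆x∷xs; ∷⁺ʳ; ∈-∷⁺ʳ; ⊆-trans; ++⁺ʳ)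
open import Data.List.Relation.Unary.All as All using (All; []; _∷_)
open import Data.List.Relation.Unary.All.Properties as Allₚ
  using (++⁺; anti-mono; Any¬⇒¬All; All¬⇒¬Any)
open import Data.List.Relation.Unary.Any as Any using (Any; here; there)
import Data.List.Relation.Unary.Any.Properties as Anyₚ
open import Data.Maybe.Base using (Maybe; just; nothing)
open import Data.Product using (∃; ∃-syntax; Σ-syntax; _×_; _,_; proj₁; proj₂)
open import Data.Sum.Base using (_⊎_; inj₁; inj₂; [_,_]′)
open import Data.Unit.Polymorphic.Base using (⊤; tt)
open import Function.Base using (_∘_; case_of_)
open import Function.Bundles using (_⇔_; mk⇔) renaming (module Equivalence to ⇔)
open import Relation.Binary.Bundles using (Poset)
open import Relation.Binary.Definitions using (_Respects_)
import Relation.Binary.Lattice as Order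
open import Relation.Binary.PropositionalEquality using (_≡_; subst) renaming (refl to ≡-refl)
open import Relation.Binary.Structures using (IsPartialOrder)
open import Relation.Nullary using (¬_; yes; no; does; contradiction)
open import Relation.Nullary.Decidable using (dec-true; decidable-stable)
open import Relation.Unary using (Pred; _∈_; _∉_; _⊆_; _≐_; _∩_; _∪_; ∁; ⋃; _⊢_)
import Relation.Unary.Algebra as UnaryAlgebra

-- `ExcludedMiddle` decides arbitrary types and returns an inhabitant when there is one, so a
-- double-negated existence statement already yields a witness. This takes the place of the axiom of
-- choice: it picks the elements added in the maximality argument, the neighbourhoods in compactness
-- arguments and the inverses of surjections. All existence of prime filters comes from one
-- extension theorem, `prime-extension`, whose notion of consistency is a parameter: one choice
-- separates elements of an algebra, another gives compactness of the spectrum. `Basis` likewise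
-- serves both directions of the duality. For the spectrum of an algebra it shows that every clopen
-- down-set comes from an element; for the clopen down-sets of a space it shows that every prime
-- filter comes from a point.

-- Excluded middle decides every type into a Boolean, so subsets can be coded as
-- Boolean functions, which do not raise the universe level.
module Classical (em : ∀ {a} → ExcludedMiddle a) (ℓ : Level) where

  -- `b ≡ true` lives at level zero; the record raises it to ℓ, so that a Boolean function becomes a
  -- `Pred _ ℓ` as `Topology` requires.
  record Holds (b : Bool) : Set ℓ where
    constructor holds
    field is-true : b ≡ true

  abstract
    ⌜_⌝ : ∀ {p} → Set p → Bool
    ⌜ P ⌝ = does (em {P = P})

    reify : ∀ {p} {P : Set p} → P → Holds ⌜ P ⌝
    reify x = holds (dec-true em x)

    reflect : ∀ {p} {P : Set p} → Holds ⌜ P ⌝ → P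
    reflect {P = P} (holds e) with em {P = P} | e
    ... | yes x | _ = x
    ... | no  _ | ()

    by-contradiction : ∀ {p} {P : Set p} → ¬ ¬ P → P
    by-contradiction = decidable-stable em

    ¬∀⇒∃¬ : ∀ {a p} {A : Set a} {P : A → Set p} → ¬ (∀ x → P x) → ∃[ x ] ¬ P x
    ¬∀⇒∃¬ ¬∀ = by-contradiction λ ¬∃ → ¬∀ λ x → by-contradiction λ ¬Px → ¬∃ (x , ¬Px)

    ¬holds⇒false : ∀ {b} → ¬ Holds b → b ≡ false
    ¬holds⇒false {true}  ¬h = ⊥-elim (¬h (holds ≡-refl))
    ¬holds⇒false {false} _  = ≡-refl

-- Zorn's lemma for properties of finite character, by the Bourbaki-Witt argument.

module Zorn (em : ∀ {a} → ExcludedMiddle a) (ext : ∀ {a b} → Extensionality a b) (ℓ : Level)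
            {B : Set ℓ} where
  open Classical em ℓ

  infix 4 _⊑_
  _⊑_ : (S T : B → Bool) → Set ℓ
  S ⊑ T = ∀ b → Holds (S b) → Holds (T b)

  -- The inflationary map `f` need not respect mutual inclusion, since `extend` adds an element
  -- chosen by excluded middle. Propositional equality is therefore needed to pass from `S` to
  -- `f S`, and this is where function extensionality enters.
  ⊑-antisym : ∀ {S T} → S ⊑ T → T ⊑ S → S ≡ T
  ⊑-antisym S⊑T T⊑S = ext λ b → bool-ext (S⊑T b) (T⊑S b)
    where
    bool-ext : ∀ {b c} → (Holds b → Holds c) → (Holds c → Holds b) → b ≡ c
    bool-ext {true}  {true}  _ _ = ≡-refl
    bool-ext {false} {false} _ _ = ≡-refl
    bool-ext {true}  {false} p _ = case p (holds ≡-refl) of λ { (holds ()) }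
    bool-ext {false} {true}  _ q = case q (holds ≡-refl) of λ { (holds ()) }

  ⨆ : ((B → Bool) → Bool) → B → Bool
  ⨆ p b = ⌜ (∃[ S ] Holds (p S) × Holds (S b)) ⌝

  ⊑⨆ : ∀ {p S} → Holds (p S) → S ⊑ ⨆ p
  ⊑⨆ pS b Sb = reify (_ , pS , Sb)

  ⨆⁻ : ∀ {p b} → Holds (⨆ p b) → ∃[ S ] Holds (p S) × Holds (S b)
  ⨆⁻ = reflect

  -- The tower of the Bourbaki–Witt theorem.
  module Tower (f : (B → Bool) → B → Bool) (inflationary : ∀ S → S ⊑ f S) where

    -- Joins are taken of arbitrary coded families of stages, not of chains; comparability is
    -- derived in `total`. The family of all stages is itself coded, so its join `top` is a stage.
    data Stage : (B → Bool) → Set ℓ where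
      step : ∀ {S} → Stage S → Stage (f S)
      sup  : ∀ p → (∀ S → Holds (p S) → Stage S) → Stage (⨆ p)

    Extreme : (B → Bool) → Set ℓ
    Extreme S = ∀ {T} → Stage T → T ⊑ S → ¬ (S ⊑ T) → f T ⊑ S

    f-mono-≡ : ∀ {S T} → S ⊑ T → T ⊑ S → f S ⊑ f T
    f-mono-≡ S⊑T T⊑S with ⊑-antisym S⊑T T⊑S
    ... | ≡-refl = λ _ h → h

    -- By induction on the stage `T`: a step cannot jump past an extreme `S`, and a join stays below
    -- `S` unless some member has already reached `f S`.
    extreme-dichotomy : ∀ {S T} → Extreme S → Stage T → T ⊑ S ⊎ f S ⊑ T
    extreme-dichotomy {S} ex (step {T} t) with extreme-dichotomy ex t
    ... | inj₂ fS⊑T = inj₂ λ b h → inflationary T b (fS⊑T b h)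
    ... | inj₁ T⊑S with em {P = S ⊑ T}
    ...   | yes S⊑T = inj₂ (f-mono-≡ S⊑T T⊑S)
    ...   | no  S⋢T = inj₁ (ex t T⊑S S⋢T)
    extreme-dichotomy {S} ex (sup p ts) with em {P = ∃[ T ] Holds (p T) × f S ⊑ T}
    ... | yes (T , pT , fS⊑T) = inj₂ λ b h → ⊑⨆ pT b (fS⊑T b h)
    ... | no  none = inj₁ λ b h → let (T , pT , Tb) = ⨆⁻ h in
      case extreme-dichotomy ex (ts T pT) of λ
        { (inj₁ T⊑S)  → T⊑S b Tb
        ; (inj₂ fS⊑T) → contradiction (T , pT , fS⊑T) none }

    extreme : ∀ {S} → Stage S → Extreme S
    extreme (step {S} s) {T} t T⊑fS fS⋢T with extreme-dichotomy (extreme s) t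
    ... | inj₂ fS⊑T = contradiction fS⊑T fS⋢T
    ... | inj₁ T⊑S with em {P = S ⊑ T}
    ...   | yes S⊑T = f-mono-≡ T⊑S S⊑T
    ...   | no  S⋢T = λ b h → inflationary S b (extreme s t T⊑S S⋢T b h)
    extreme (sup p ss) {T} t _ ⨆⋢T with em {P = ∃[ S ] Holds (p S) × ¬ (S ⊑ T)}
    ... | no none = ⊥-elim (⨆⋢T λ b h → let (S , pS , Sb) = ⨆⁻ h in
                      by-contradiction λ ¬Tb → none (S , pS , λ S⊑T → ¬Tb (S⊑T b Sb)))
    ... | yes (S , pS , S⋢T) with extreme-dichotomy (extreme (ss S pS)) t
    ...   | inj₁ T⊑S  = λ b h → ⊑⨆ pS b (extreme (ss S pS) t T⊑S S⋢T b h)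
    ...   | inj₂ fS⊑T = contradiction (λ b h → fS⊑T b (inflationary S b h)) S⋢T

    total : ∀ {S T} → Stage S → Stage T → S ⊑ T ⊎ T ⊑ S
    total {S} s t with extreme-dichotomy (extreme s) t
    ... | inj₁ T⊑S  = inj₂ T⊑S
    ... | inj₂ fS⊑T = inj₁ λ b h → fS⊑T b (inflationary S b h)

    top : B → Bool
    top = ⨆ λ S → ⌜ Stage S ⌝

    top-stage : Stage top
    top-stage = sup _ λ _ → reflect

    top-fixed : f top ⊑ top
    top-fixed = ⊑⨆ (reify (step top-stage))

  module FiniteCharacter {c} (C : List B → Set c) (C[] : C [])
                         (C-mono : ∀ {l m} → l ⊆ₗ m → C m → C l) where

    Within : (B → Bool) → List B → Set ℓ
    Within S = All (Holds ∘ S)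

    Consistent : (B → Bool) → Set _
    Consistent S = ∀ l → Within S l → C l

    Addable : (B → Bool) → B → Set _
    Addable S b = ¬ Holds (S b) × (∀ l → Within S l → C (b ∷ l))

    insert : B → (B → Bool) → B → Bool
    insert b S x = ⌜ (Holds (S x) ⊎ x ≡ b) ⌝

    -- The choice function of Zorn's lemma: deciding `∃ (Addable S)` also delivers the element to
    -- add.
    extend : (B → Bool) → B → Bool
    extend S with em {P = ∃ (Addable S)}
    ... | yes (b , _) = insert b S
    ... | no  _       = S

    extend-inflationary : ∀ S → S ⊑ extend S
    extend-inflationary S with em {P = ∃ (Addable S)}
    ... | yes _ = λ _ h → reify (inj₁ h)
    ... | no  _ = λ _ h → h

    insert⁻ : ∀ {S b l} → Within (insert b S) l → ∃[ m ] Within S m × l ⊆ₗ (b ∷ m)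
    insert⁻ [] = [] , [] , λ ()
    insert⁻ {b = b} (h ∷ hs) with reflect h | insert⁻ hs
    ... | inj₂ ≡-refl | m , ms , l⊆ = m , ms , ∈-∷⁺ʳ (here ≡-refl) l⊆
    ... | inj₁ Sx   | m , ms , l⊆ =
      _ , Sx ∷ ms , ∈-∷⁺ʳ (there (here ≡-refl)) (⊆-trans l⊆ (∷⁺ʳ b (xs⊆x∷xs m _)))

    extend-consistent : ∀ {S} → Consistent S → Consistent (extend S)
    extend-consistent {S} con with em {P = ∃ (Addable S)}
    ... | no  _ = con
    ... | yes (_ , _ , add) = λ l hs → let (m , ms , l⊆) = insert⁻ hs in C-mono l⊆ (add m ms)

    open Tower extend extend-inflationary

    -- A finite list drawn from the union of a chain is drawn from one member. The empty list stands
    -- apart because the family `p` may have no member.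
    within-⨆ : ∀ {p l} → (∀ S → Holds (p S) → Stage S) → Within (⨆ p) l →
               l ≡ [] ⊎ (∃[ S ] Holds (p S) × Within S l)
    within-⨆ ts [] = inj₁ ≡-refl
    within-⨆ ts (h ∷ hs) with ⨆⁻ h | within-⨆ ts hs
    ... | S , pS , Sb | inj₁ ≡-refl = inj₂ (S , pS , Sb ∷ [])
    ... | S , pS , Sb | inj₂ (T , pT , Ts) with total (ts S pS) (ts T pT)
    ...   | inj₁ S⊑T = inj₂ (T , pT , S⊑T _ Sb ∷ Ts)
    ...   | inj₂ T⊑S = inj₂ (S , pS , Sb ∷ All.map (T⊑S _) Ts)

    stage-consistent : ∀ {S} → Stage S → Consistent S
    stage-consistent (step s)   = extend-consistent (stage-consistent s)
    stage-consistent (sup p ss) l hs with within-⨆ ss hs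
    ... | inj₁ ≡-refl            = C[]
    ... | inj₂ (S , pS , hs′) = stage-consistent (ss S pS) l hs′

    top-not-addable : ¬ ∃ (Addable top)
    top-not-addable = go top-fixed
      where
      go : ∀ {S} → extend S ⊑ S → ¬ ∃ (Addable S)
      go {S} fixed with em {P = ∃ (Addable S)}
      ... | no  none          = none
      ... | yes (b , ¬Sb , _) = λ _ → ¬Sb (fixed b (reify (inj₂ ≡-refl)))

    top-consistent : Consistent top
    top-consistent = stage-consistent top-stage

    top-maximal : ∀ b → ¬ Holds (top b) → ∃[ l ] Within top l × ¬ C (b ∷ l)
    top-maximal b ¬b = by-contradiction λ none → top-not-addable
      (b , ¬b , λ l hs → by-contradiction λ ¬C → none (l , hs , ¬C))

-- Compactness of propositional logic: a finitely consistent theory in the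
-- variables V is satisfied by some valuation.
module Valuations (em : ∀ {a} → ExcludedMiddle a) (ext : ∀ {a b} → Extensionality a b) (ℓ : Level)
                  {V : Set ℓ} where
  open Classical em ℓ

  Literal : Set ℓ
  Literal = V × Bool

  infix 4 _⊨_
  _⊨_ : (V → Bool) → List Literal → Set ℓ
  v ⊨ l = All (λ (a , b) → v a ≡ b) l

  abstract
    -- A maximal consistent set of literals decides every variable. If it omitted both literals of
    -- `a`, finite lists `l` and `m` would witness the two refusals, and `split` applied to `l ++ m`
    -- would contradict one of them.
    valuation : ∀ {c} (C : List Literal → Set c) → C [] →
                (∀ {l m} → l ⊆ₗ m → C m → C l) →
                (∀ a {l} → C l → C ((a , true) ∷ l) ⊎ C ((a , false) ∷ l)) →
                ∃[ v ] (∀ l → v ⊨ l → C l)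
    valuation C C[] C-mono split = v , λ l v⊨l → top-consistent l (All.map in-top v⊨l)
      where
      open Zorn.FiniteCharacter em ext ℓ C C[] C-mono
      open Zorn.Tower em ext ℓ extend extend-inflationary using (top)

      v : V → Bool
      v a = top (a , true)

      decided : ∀ a → ¬ Holds (top (a , true)) → Holds (top (a , false))
      decided a ¬t = by-contradiction λ ¬f →
        let (l , hl , ¬Cl) = top-maximal (a , true)  ¬t
            (m , hm , ¬Cm) = top-maximal (a , false) ¬f
        in case split a (top-consistent (l ++ m) (++⁺ hl hm)) of λ
          { (inj₁ Ct) → ¬Cl (C-mono (∷⁺ʳ _ (xs⊆xs++ys l m)) Ct)
          ; (inj₂ Cf) → ¬Cm (C-mono (∷⁺ʳ _ (xs⊆ys++xs m l)) Cf) }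

      in-top : ∀ {ab} → v (proj₁ ab) ≡ proj₂ ab → Holds (top ab)
      in-top {a , true}  va = holds va
      in-top {a , false} va = decided a λ { (holds t) → case subst (_≡ true) va t of λ () }

-- The Priestley space of prime filters.

module Spectrum (em : ∀ {a} → ExcludedMiddle a) (ext : ∀ {a b} → Extensionality a b) (ℓ : Level)
                (A : ⊖-Algebra ℓ) where
  open Classical em ℓ
  open ⊖-Algebra A using (Carrier; _≈_; _∧_; _∨_; 0#; 1#; ∨-identity; ∧-identity)
  private
    module A = ⊖-Algebra A
    lattice : Lattice ℓ ℓ
    lattice = record { isLattice = A.isLattice }
  open Order.Lattice (LatticeProperties.∨-∧-orderTheoreticLattice lattice) public
    using (_≤_; x∧y≤x; x∧y≤y; ∧-greatest; x≤x∨y; y≤x∨y; ∨-least; antisym)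
    renaming (refl to ≤-refl; trans to ≤-trans; reflexive to ≤-reflexive)

  ≤1 : ∀ a → a ≤ 1#
  ≤1 a = A.sym (proj₂ ∧-identity a)

  0≤ : ∀ a → 0# ≤ a
  0≤ a = ≤-trans (x≤x∨y 0# a) (≤-reflexive (proj₁ ∨-identity a))

  -- The cut rule for sequents from `p` to `n`; this is where distributivity enters the prime filter
  -- theorem.
  cut : ∀ {p c n} → p ∧ c ≤ n → p ≤ n ∨ c → p ≤ n
  cut {p} {c} {n} pc≤n p≤nc =
    ≤-trans (∧-greatest ≤-refl p≤nc)
      (≤-trans (≤-reflexive (A.∧-distribˡ-∨ p n c)) (∨-least (x∧y≤y p n) pc≤n))

  -- A bounded lattice homomorphism to truth values, with upward closure as the consequence `up`. It
  -- is kept apart from `Point` so that primality is checked on an ordinary predicate before the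
  -- predicate is coded.
  record IsPrime (P : Pred Carrier ℓ) : Set ℓ where
    field
      resp : P Respects _≈_
      ∧⁺   : ∀ {a b} → P a → P b → P (a ∧ b)
      ∧⁻   : ∀ {a b} → P (a ∧ b) → P a × P b
      ∨⁺   : ∀ {a b} → P a ⊎ P b → P (a ∨ b)
      ∨⁻   : ∀ {a b} → P (a ∨ b) → P a ⊎ P b
      1∈   : P 1#
      0∉   : ¬ P 0#

    up : ∀ {a b} → a ≤ b → P a → P b
    up a≤b a∈ = proj₂ (∧⁻ (resp a≤b a∈))

  record Point : Set ℓ where
    no-eta-equality
    field
      mem     : Carrier → Bool
      isPrime : IsPrime (Holds ∘ mem)
    open IsPrime isPrime public

  infix 4 _∋_
  _∋_ : Point → Carrier → Set ℓ
  x ∋ a = Holds (Point.mem x a)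

  abstract
    coded-prime : ∀ {P} → IsPrime P → IsPrime (λ a → Holds ⌜ P a ⌝)
    coded-prime prime = record
      { resp = λ e p → reify (resp e (reflect p))
      ; ∧⁺   = λ p q → reify (∧⁺ (reflect p) (reflect q))
      ; ∧⁻   = λ p → let (q , r) = ∧⁻ (reflect p) in reify q , reify r
      ; ∨⁺   = λ { (inj₁ p) → reify (∨⁺ (inj₁ (reflect p)))
                 ; (inj₂ p) → reify (∨⁺ (inj₂ (reflect p))) }
      ; ∨⁻   = λ p → [ inj₁ ∘ reify , inj₂ ∘ reify ]′ (∨⁻ (reflect p))
      ; 1∈   = reify 1∈
      ; 0∉   = λ p → 0∉ (reflect p)
      } where open IsPrime prime

  point : ∀ {P} → IsPrime P → Point
  point {P} prime = record { mem = λ a → ⌜ P a ⌝ ; isPrime = coded-prime prime }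

  open Valuations em ext ℓ {Carrier}

  meets joins : List Literal → Carrier
  meets []                = 1#
  meets ((a , true)  ∷ l) = a ∧ meets l
  meets ((_ , false) ∷ l) = meets l
  joins []                = 0#
  joins ((_ , true)  ∷ l) = joins l
  joins ((a , false) ∷ l) = a ∨ joins l

  abstract
    meets≤ : ∀ {a l} → (a , true) ∈ₗ l → meets l ≤ a
    meets≤ {l = _ ∷ l}           (here ≡-refl) = x∧y≤x _ (meets l)
    meets≤ {l = (_ , true)  ∷ l} (there m)   = ≤-trans (x∧y≤y _ (meets l)) (meets≤ m)
    meets≤ {l = (_ , false) ∷ l} (there m)   = meets≤ m

    ≤joins : ∀ {a l} → (a , false) ∈ₗ l → a ≤ joins l
    ≤joins {l = _ ∷ l}           (here ≡-refl) = x≤x∨y _ (joins l)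
    ≤joins {l = (_ , true)  ∷ l} (there m)   = ≤joins m
    ≤joins {l = (_ , false) ∷ l} (there m)   = ≤-trans (≤joins m) (y≤x∨y _ (joins l))

    ≤meets : ∀ {p} l → (∀ {a} → (a , true) ∈ₗ l → p ≤ a) → p ≤ meets l
    ≤meets []                h = ≤1 _
    ≤meets ((_ , true)  ∷ l) h = ∧-greatest (h (here ≡-refl)) (≤meets l (h ∘ there))
    ≤meets ((_ , false) ∷ l) h = ≤meets l (h ∘ there)

    joins≤ : ∀ {n} l → (∀ {a} → (a , false) ∈ₗ l → a ≤ n) → joins l ≤ n
    joins≤ []                h = 0≤ _
    joins≤ ((_ , true)  ∷ l) h = joins≤ l (h ∘ there)
    joins≤ ((_ , false) ∷ l) h = ∨-least (h (here ≡-refl)) (joins≤ l (h ∘ there))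

  -- Literals form a sequent, the positive ones on the left and the negative ones on the right. A
  -- derivable sequent is satisfied by no prime filter.
  Contradictory : List Literal → Set ℓ
  Contradictory l = meets l ≤ joins l

  abstract
    contradictory-mono : ∀ {l m} → l ⊆ₗ m → Contradictory l → Contradictory m
    contradictory-mono {l} {m} l⊆m c =
      ≤-trans (≤meets l (meets≤ ∘ l⊆m)) (≤-trans c (joins≤ l (≤joins ∘ l⊆m)))

    -- Each violation of a prime filter law is visible on at most three literals, and those literals
    -- are contradictory.
    valuation-prime : ∀ {v} → (∀ l → v ⊨ l → ¬ Contradictory l) → IsPrime (Holds ∘ v)
    valuation-prime {v} con = record
      { resp = λ {a} {b} a≈b → λ { (holds p) → prove λ q →
          con ((a , true) ∷ (b , false) ∷ []) (p ∷ q ∷ [])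
            (≤-trans (x∧y≤x _ _) (≤-trans (≤-reflexive a≈b) (x≤x∨y _ _))) }
      ; ∧⁺ = λ {a} {b} → λ { (holds p) (holds q) → prove λ r →
          con ((a , true) ∷ (b , true) ∷ (a ∧ b , false) ∷ []) (p ∷ q ∷ r ∷ [])
            (≤-trans (∧-greatest (x∧y≤x _ _) (≤-trans (x∧y≤y _ _) (x∧y≤x _ _))) (x≤x∨y _ _)) }
      ; ∧⁻ = λ {a} {b} → λ { (holds p) →
          (prove λ q → con ((a ∧ b , true) ∷ (a , false) ∷ []) (p ∷ q ∷ [])
            (≤-trans (x∧y≤x _ _) (≤-trans (x∧y≤x _ _) (x≤x∨y _ _)))) ,
          (prove λ q → con ((a ∧ b , true) ∷ (b , false) ∷ []) (p ∷ q ∷ [])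
            (≤-trans (x∧y≤x _ _) (≤-trans (x∧y≤y _ _) (x≤x∨y _ _)))) }
      ; ∨⁺ = λ {a} {b} → λ
          { (inj₁ (holds p)) → prove λ q → con ((a , true) ∷ (a ∨ b , false) ∷ []) (p ∷ q ∷ [])
              (≤-trans (x∧y≤x _ _) (≤-trans (x≤x∨y _ _) (x≤x∨y _ _)))
          ; (inj₂ (holds p)) → prove λ q → con ((b , true) ∷ (a ∨ b , false) ∷ []) (p ∷ q ∷ [])
              (≤-trans (x∧y≤x _ _) (≤-trans (y≤x∨y _ _) (x≤x∨y _ _))) }
      ; ∨⁻ = λ {a} {b} → λ { (holds p) → by-contradiction λ n →
          con ((a ∨ b , true) ∷ (a , false) ∷ (b , false) ∷ [])
            (p ∷ ¬holds⇒false (n ∘ inj₁) ∷ ¬holds⇒false (n ∘ inj₂) ∷ [])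
            (≤-trans (x∧y≤x _ _) (∨-least (x≤x∨y _ _) (≤-trans (x≤x∨y _ _) (y≤x∨y _ _)))) }
      ; 1∈ = prove λ p → con ((1# , false) ∷ []) (p ∷ []) (x≤x∨y _ _)
      ; 0∉ = λ { (holds p) → con ((0# , true) ∷ []) (p ∷ []) (x∧y≤x _ _) }
      }
      where
      prove : ∀ {a} → ¬ (v a ≡ false) → Holds (v a)
      prove n = by-contradiction (n ∘ ¬holds⇒false)

    -- `C` is an arbitrary notion of consistency stronger than not being contradictory. It is
    -- instantiated by consistency with a fixed pair of literals and by the absence of a finite
    -- subcover.
    prime-extension : ∀ {c} (C : List Literal → Set c) → C [] →
                      (∀ {l m} → l ⊆ₗ m → C m → C l) →
                      (∀ a {l} → C l → C ((a , true) ∷ l) ⊎ C ((a , false) ∷ l)) →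
                      (∀ l → C l → ¬ Contradictory l) →
                      ∃[ x ] (∀ l → Point.mem x ⊨ l → C l)
    prime-extension C C[] mono split sound with valuation C C[] mono split
    ... | v , vC = record { mem = v ; isPrime = valuation-prime λ l v⊨l → sound l (vC l v⊨l) } , vC

    prime-filter-theorem : ∀ {a b} → ¬ (a ≤ b) → ∃[ x ] x ∋ a × ¬ x ∋ b
    prime-filter-theorem {a} {b} a≰b = x , a∈x , b∉x
      where
      seed : List Literal
      seed = (a , true) ∷ (b , false) ∷ []

      Con : List Literal → Set ℓ
      Con l = ¬ Contradictory (seed ++ l)

      split : ∀ c {l} → Con l → Con ((c , true) ∷ l) ⊎ Con ((c , false) ∷ l)
      split c {l} con with em {P = Con ((c , true) ∷ l)}
      ... | yes p = inj₁ p
      ... | no ¬p = inj₂ λ q → con (contradictory-cut (by-contradiction ¬p) q)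
        where
        contradictory-cut : Contradictory (seed ++ (c , true) ∷ l) →
                            Contradictory (seed ++ (c , false) ∷ l) → Contradictory (seed ++ l)
        contradictory-cut t f = cut {c = c}
          (≤-trans (∧-greatest (≤-trans (x∧y≤x _ _) (x∧y≤x _ _))
                     (∧-greatest (x∧y≤y _ _) (≤-trans (x∧y≤x _ _) (x∧y≤y _ _)))) t)
          (≤-trans f (∨-least (≤-trans (x≤x∨y _ _) (x≤x∨y _ _))
                     (∨-least (y≤x∨y _ _) (≤-trans (y≤x∨y _ _) (x≤x∨y _ _)))))

      extension : ∃[ x ] (∀ l → Point.mem x ⊨ l → Con l)
      extension = prime-extension Con
        (λ c → a≰b (≤-trans (∧-greatest ≤-refl (≤1 a)) (≤-trans c (∨-least ≤-refl (0≤ b)))))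
        (λ l⊆m con → con ∘ contradictory-mono (++⁺ʳ seed l⊆m))
        split
        (λ l con → con ∘ contradictory-mono (xs⊆ys++xs l seed))

      x : Point
      x = proj₁ extension

      a∈x : x ∋ a
      a∈x = by-contradiction λ a∉x → proj₂ extension ((a , false) ∷ []) (¬holds⇒false a∉x ∷ [])
        (≤-trans (x∧y≤x _ _) (≤-trans (x≤x∨y a 0#) (y≤x∨y b _)))

      b∉x : ¬ x ∋ b
      b∉x (holds p) = proj₂ extension ((b , true) ∷ []) (p ∷ [])
        (≤-trans (≤-trans (x∧y≤y a _) (x∧y≤x b _)) (x≤x∨y b _))

  infix 4 _≤ᵖ_
  _≤ᵖ_ : Point → Point → Set ℓ
  x ≤ᵖ y = ∀ a → y ∋ a → x ∋ a

  abstract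
    ≰ᵖ⇒ : ∀ {x y} → ¬ (x ≤ᵖ y) → ∃[ a ] y ∋ a × ¬ x ∋ a
    ≰ᵖ⇒ x≰y = let (a , n) = ¬∀⇒∃¬ x≰y in
      a , by-contradiction (λ a∉y → n λ a∈y → ⊥-elim (a∉y a∈y)) , λ a∈x → n λ _ → a∈x

  infix 4 _≈ᵖ_
  _≈ᵖ_ : Point → Point → Set ℓ
  x ≈ᵖ y = x ≤ᵖ y × y ≤ᵖ x

  -- Meets and joins in the lattice make the sets given by `a` in and `b` out closed under finite
  -- intersection, so they form a base and not merely a subbase. `Lift` adjusts the level to that of
  -- `Open`.
  IsOpen : Pred (Pred Point ℓ) (suc ℓ)
  IsOpen U = Lift (suc ℓ) (∀ x → x ∈ U →
    ∃[ a ] ∃[ b ] (x ∋ a × ¬ x ∋ b × (∀ y → y ∋ a → ¬ y ∋ b → y ∈ U)))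

  abstract
    ≤ᵖ-isPartialOrder : IsPartialOrder _≈ᵖ_ _≤ᵖ_
    ≤ᵖ-isPartialOrder = record
      { isPreorder = record
        { isEquivalence = record
          { refl  = (λ _ p → p) , (λ _ p → p)
          ; sym   = λ (p , q) → q , p
          ; trans = λ (p , q) (r , s) → (λ a → p a ∘ r a) , (λ a → s a ∘ q a)
          }
        ; reflexive = proj₁
        ; trans     = λ p q a → p a ∘ q a
        }
      ; antisym = _,_
      }

    open-resp-≈ : ∀ {U} → IsOpen U → U Respects _≈ᵖ_
    open-resp-≈ (lift o) (x≤y , y≤x) x∈U = let (a , b , a∈ , b∉ , sub) = o _ x∈U in
      sub _ (y≤x a a∈) (b∉ ∘ x≤y b)

    open-resp-≐ : ∀ {U V} → U ≐ V → IsOpen U → IsOpen V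
    open-resp-≐ (U⊆V , V⊆U) (lift o) = lift λ x x∈V →
      let (a , b , a∈ , b∉ , sub) = o x (V⊆U x∈V) in
      a , b , a∈ , b∉ , λ y p q → U⊆V (sub y p q)

    open-whole : IsOpen (λ _ → ⊤)
    open-whole = lift λ x _ → 1# , 0# , Point.1∈ x , Point.0∉ x , _

    open-inter : ∀ {U V} → IsOpen U → IsOpen V → IsOpen (U ∩ V)
    open-inter (lift o) (lift o′) = lift λ x (x∈U , x∈V) →
      let (a  , b  , a∈  , b∉  , sub ) = o  x x∈U
          (a′ , b′ , a′∈ , b′∉ , sub′) = o′ x x∈V
      in a ∧ a′ , b ∨ b′ , Point.∧⁺ x a∈ a′∈ , [ b∉ , b′∉ ]′ ∘ Point.∨⁻ x ,
         λ y p q → sub  y (proj₁ (Point.∧⁻ y p)) (q ∘ Point.∨⁺ y ∘ inj₁) ,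
                   sub′ y (proj₂ (Point.∧⁻ y p)) (q ∘ Point.∨⁺ y ∘ inj₂)

    open-union : ∀ {I : Set ℓ} {U : I → Pred Point ℓ} → (∀ i → IsOpen (U i)) → IsOpen (⋃ I U)
    open-union o = lift λ x (i , x∈U) → let (a , b , a∈ , b∉ , sub) = lower (o i) x x∈U in
      a , b , a∈ , b∉ , λ y p q → i , sub y p q

  pointPoset : Poset ℓ ℓ ℓ
  pointPoset = record { isPartialOrder = ≤ᵖ-isPartialOrder }

  pointTopology : Topology (Poset.Eq.setoid pointPoset)
  pointTopology = record
    { Open   = IsOpen
    ; resp-≈ = open-resp-≈
    ; resp-≐ = open-resp-≐
    ; whole  = open-whole
    ; inter  = open-inter
    ; union  = open-union
    }

  open Topology pointTopology

  abstract
    ∋-clopen : ∀ a → Clopen (_∋ a)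
    ∋-clopen a = (lift λ x a∈ → a , 0# , a∈ , Point.0∉ x , λ _ p _ → p) ,
                 (lift λ x a∉ → 1# , a , Point.1∈ x , a∉ , λ _ _ q → q)

    satisfied-meets : ∀ x l → Point.mem x ⊨ l → x ∋ meets l
    satisfied-meets x []                _        = Point.1∈ x
    satisfied-meets x ((_ , true)  ∷ l) (p ∷ ps) = Point.∧⁺ x (holds p) (satisfied-meets x l ps)
    satisfied-meets x ((_ , false) ∷ l) (_ ∷ ps) = satisfied-meets x l ps

    satisfied-joins : ∀ x l → Point.mem x ⊨ l → ¬ x ∋ joins l
    satisfied-joins x []                _        = Point.0∉ x
    satisfied-joins x ((_ , true)  ∷ l) (_ ∷ ps) = satisfied-joins x l ps
    satisfied-joins x ((_ , false) ∷ l) (p ∷ ps) q with Point.∨⁻ x q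
    ... | inj₁ (holds q′) = case subst (_≡ true) p q′ of λ ()
    ... | inj₂ q′         = satisfied-joins x l ps q′

    -- Call a list of literals consistent when no finite subfamily covers its models. Without a
    -- finite subcover the empty list is consistent, and a prime filter arises all of whose finite
    -- lists are consistent. But it lies in some `U i` together with a basic neighbourhood, so two
    -- of its literals are covered by `i` alone.
    pointCompact : Compact
    pointCompact {I} U open-U cover = by-contradiction λ none →
      let (x , con) = prime-extension (¬_ ∘ Covered)
            (λ (is , c) → none (is , λ x → c x []))
            (λ l⊆m n c → n (covered-mono l⊆m c))
            (λ a {l} → split a)
            -- A contradictory list has no models, so the empty subfamily covers them.
            (λ l n c → n ([] , λ x x⊨l →
               ⊥-elim (satisfied-joins x l x⊨l (Point.up x c (satisfied-meets x l x⊨l)))))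
          (i , x∈Ui) = cover x
          (a , b , a∈ , b∉ , sub) = lower (open-U i) x x∈Ui
      in con ((a , true) ∷ (b , false) ∷ []) (Holds.is-true a∈ ∷ ¬holds⇒false b∉ ∷ [])
           ((i ∷ []) , λ { y (p ∷ q ∷ []) → here (sub y (holds p)
              λ { (holds r) → case subst (_≡ true) q r of λ () }) })
      where
      Covered : List Literal → Set ℓ
      Covered l = Σ[ is ∈ List I ] (∀ x → Point.mem x ⊨ l → Any (λ i → x ∈ U i) is)

      covered-mono : ∀ {l m} → l ⊆ₗ m → Covered l → Covered m
      covered-mono l⊆m (is , c) = is , λ x x⊨m → c x (anti-mono l⊆m x⊨m)

      split : ∀ a {l} → ¬ Covered l → ¬ Covered ((a , true) ∷ l) ⊎ ¬ Covered ((a , false) ∷ l)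
      split a {l} n with em {P = Covered ((a , true) ∷ l)}
      ... | no ¬c = inj₁ ¬c
      ... | yes (is , c) = inj₂ λ (js , d) → n (is ++ js , λ x x⊨l →
        case em {P = x ∋ a} of λ
          { (yes (holds p)) → Anyₚ.++⁺ˡ (c x (p ∷ x⊨l))
          ; (no ¬p)         → Anyₚ.++⁺ʳ is (d x (¬holds⇒false ¬p ∷ x⊨l)) })

    separated : ∀ {x y} → ¬ (x ≤ᵖ y) →
                ∃[ U ] (Clopen U × DownSet pointPoset U × y ∈ U × x ∉ U)
    separated {x} {y} x≰y = let (a , a∈y , a∉x) = ≰ᵖ⇒ {x} {y} x≰y in
      (_∋ a) , ∋-clopen a , (λ x≤y → x≤y a) , a∈y , a∉x

  pointSpace : PriestleySpace ℓ
  pointSpace = record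
    { poset      = pointPoset
    ; topology   = pointTopology
    ; compact    = pointCompact
    ; separation = separated
    }

-- Closed sets and compactness in a Priestley space.

module Priestley (em : ∀ {a} → ExcludedMiddle a) (ℓ : Level) (X : PriestleySpace ℓ) where
  open Classical em ℓ
  open PriestleySpace X
  open Topology topology using (resp-≐; whole; inter; union)

  Closed : Pred (Pred Carrier ℓ) (suc ℓ)
  Closed K = Open (∁ K)

  abstract
    closed-∁ : ∀ {U} → Open U → Closed (∁ U)
    closed-∁ oU = resp-≐ ((λ x∈U n → n x∈U) , by-contradiction) oU

    ∁-upSet : ∀ {U} → DownSet poset U → UpSet poset (∁ U)
    ∁-upSet down x≤y x∉U y∈U = x∉U (down x≤y y∈U)

    -- The union is indexed by the points of `W`: index types must lie at level ℓ, which rules out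
    -- indexing by the open sets themselves.
    open-local : ∀ {W} → (∀ x → x ∈ W → ∃[ O ] (Open O × x ∈ O × O ⊆ W)) → Open W
    open-local {W} local = resp-≐
      ((λ ((x , x∈W) , y∈O) → proj₂ (proj₂ (proj₂ (local x x∈W))) y∈O) ,
       (λ {x} x∈W → (x , x∈W) , proj₁ (proj₂ (proj₂ (local x x∈W)))))
      (union {I = ∃ W} λ (x , x∈W) → proj₁ (proj₂ (local x x∈W)))

    open-∅ : Open (λ _ → Empty.⊥)
    open-∅ = open-local λ _ ()

    open-∪ : ∀ {U V} → Open U → Open V → Open (U ∪ V)
    open-∪ oU oV = open-local λ
      { _ (inj₁ x∈U) → _ , oU , x∈U , inj₁
      ; _ (inj₂ x∈V) → _ , oV , x∈V , inj₂ }

    open-All : ∀ {I : Set ℓ} {O : I → Pred Carrier ℓ} → (∀ i → Open (O i)) →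
               ∀ is → Open (λ x → All (λ i → x ∈ O i) is)
    open-All oO []       = resp-≐ ((λ _ → []) , _) whole
    open-All oO (i ∷ is) = resp-≐ ((λ (p , ps) → p ∷ ps) , λ { (p ∷ ps) → p , ps })
                                  (inter (oO i) (open-All oO is))

    clopen-∩ : ∀ {U V} → Clopen U → Clopen V → Clopen (U ∩ V)
    clopen-∩ {U} {V} (oU , cU) (oV , cV) = inter oU oV ,
      resp-≐ ((λ n (p , q) → [ (λ f → f p) , (λ f → f q) ]′ n) , deMorgan) (open-∪ cU cV)
      where
      deMorgan : ∀ {x} → x ∈ ∁ (U ∩ V) → x ∈ ∁ U ∪ ∁ V
      deMorgan {x} n with em {P = x ∈ U}
      ... | yes p = inj₂ λ q → n (p , q)
      ... | no ¬p = inj₁ ¬p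

    clopen-∪ : ∀ {U V} → Clopen U → Clopen V → Clopen (U ∪ V)
    clopen-∪ (oU , cU) (oV , cV) = open-∪ oU oV ,
      resp-≐ ((λ (m , n) → [ m , n ]′) , λ n → n ∘ inj₁ , n ∘ inj₂) (inter cU cV)

    compact-closed : ∀ {K} → Closed K → {I : Set ℓ} (U : I → Pred Carrier ℓ) →
                     (∀ i → Open (U i)) → (∀ x → x ∈ K → ∃[ i ] x ∈ U i) →
                     Σ[ is ∈ List I ] (∀ x → x ∈ K → Any (λ i → x ∈ U i) is)
    compact-closed {K} closed {I} U oU cover =
      let (ms , c) = compact V oV coverV in catMaybes ms , λ x x∈K → strip x∈K ms (c x)
      where
      V : Maybe I → Pred Carrier ℓ
      V nothing  = ∁ K
      V (just i) = U i

      oV : ∀ m → Open (V m)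
      oV nothing  = closed
      oV (just i) = oU i

      coverV : ∀ x → ∃[ m ] x ∈ V m
      coverV x with em {P = x ∈ K}
      ... | yes p = let (i , q) = cover x p in just i , q
      ... | no ¬p = nothing , ¬p

      strip : ∀ {x} → x ∈ K → ∀ ms → Any (λ m → x ∈ V m) ms → Any (λ i → x ∈ U i) (catMaybes ms)
      strip x∈K (nothing ∷ ms) (here x∉K) = contradiction x∈K x∉K
      strip x∈K (nothing ∷ ms) (there p)  = strip x∈K ms p
      strip x∈K (just i  ∷ ms) (here p)   = here p
      strip x∈K (just i  ∷ ms) (there p)  = there (strip x∈K ms p)

    -- The tube lemma. It turns a condition that holds near each pair into one that holds near `x`
    -- against all of a compact set at once; both `diff-closed` and `starDiff-open` rest on it.
    tube : ∀ {r} {K} {R : Carrier → Carrier → Set r} {x} → Closed K →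
           (∀ k → k ∈ K → ∃[ O ] ∃[ P ] (Open O × Open P × x ∈ O × k ∈ P ×
                            (∀ {x′ k′} → x′ ∈ O → k′ ∈ P → R x′ k′))) →
           ∃[ O ] (Open O × x ∈ O × (∀ {x′ k} → x′ ∈ O → k ∈ K → R x′ k))
    tube {K = K} {R} {x} closed local =
      let (ks , cover) = compact-closed closed {∃ K} (λ (k , k∈) → P k k∈) (λ (k , k∈) → oP k k∈)
                           (λ k k∈ → (k , k∈) , k∈P k k∈)
      in (λ x′ → All (λ (k , k∈) → x′ ∈ O k k∈) ks) , open-All (λ (k , k∈) → oO k k∈) ks ,
         All.universal (λ (k , k∈) → x∈O k k∈) ks ,
         λ os k∈ → let ((k′ , k′∈) , o , p) = pick os (cover _ k∈) in rel k′ k′∈ o p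
      where
      O P : ∀ k → k ∈ K → Pred Carrier ℓ
      O k k∈ = proj₁ (local k k∈)
      P k k∈ = proj₁ (proj₂ (local k k∈))

      oO : ∀ k (k∈ : k ∈ K) → Open (O k k∈)
      oO k k∈ = let (_ , _ , o , _) = local k k∈ in o
      oP : ∀ k (k∈ : k ∈ K) → Open (P k k∈)
      oP k k∈ = let (_ , _ , _ , o , _) = local k k∈ in o
      x∈O : ∀ k (k∈ : k ∈ K) → x ∈ O k k∈
      x∈O k k∈ = let (_ , _ , _ , _ , p , _) = local k k∈ in p
      k∈P : ∀ k (k∈ : k ∈ K) → k ∈ P k k∈
      k∈P k k∈ = let (_ , _ , _ , _ , _ , p , _) = local k k∈ in p
      rel : ∀ k (k∈ : k ∈ K) {x′ k′} → x′ ∈ O k k∈ → k′ ∈ P k k∈ → R x′ k′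
      rel k k∈ = let (_ , _ , _ , _ , _ , _ , p) = local k k∈ in p

      pick : ∀ {I : Set ℓ} {Q S : I → Set ℓ} {is} → All Q is → Any S is → ∃[ i ] Q i × S i
      pick (q ∷ _)  (here s)  = _ , q , s
      pick (_ ∷ qs) (there s) = pick qs s

-- A family of clopen down-sets of X, closed under finite intersections and
-- unions and indexed by B, which separates the points of X.
module Basis (em : ∀ {a} → ExcludedMiddle a) (ext : ∀ {a b} → Extensionality a b) (ℓ : Level)
             (X : PriestleySpace ℓ) (B : ⊖-Algebra ℓ)
             (⟦_⟧ : ⊖-Algebra.Carrier B → Pred (PriestleySpace.Carrier X) ℓ)
             (prime : ∀ x → Spectrum.IsPrime em ext ℓ B (λ b → ⟦ b ⟧ x))
             (clopen : ∀ b → PriestleySpace.Clopen X ⟦ b ⟧)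
             (down : ∀ b → DownSet (PriestleySpace.poset X) ⟦ b ⟧)
             (separates : ∀ {x y} → ¬ PriestleySpace._≤_ X x y → ∃[ b ] (⟦ b ⟧ y × ¬ ⟦ b ⟧ x))
             where
  open Classical em ℓ
  open PriestleySpace X
  open Priestley em ℓ X
  open Spectrum em ext ℓ B using (IsPrime) renaming (_≤_ to _≤ᴮ_)
  open ⊖-Algebra B using (_∧_; _∨_; 0#; 1#) renaming (Carrier to ∣B∣)

  private
    module Prime x = IsPrime (prime x)

  ⋀ ⋁ : List ∣B∣ → ∣B∣
  ⋀ = foldr _∧_ 1#
  ⋁ = foldr _∨_ 0#

  module _ {Y : Pred ∣B∣ ℓ} (Y-prime : IsPrime Y) where
    open IsPrime Y-prime

    abstract
      ⋀⁺ : ∀ {bs} → All Y bs → Y (⋀ bs)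
      ⋀⁺ []       = 1∈
      ⋀⁺ (p ∷ ps) = ∧⁺ p (⋀⁺ ps)

      ⋀⁻ : ∀ bs → Y (⋀ bs) → All Y bs
      ⋀⁻ []       _ = []
      ⋀⁻ (b ∷ bs) p = proj₁ (∧⁻ p) ∷ ⋀⁻ bs (proj₂ (∧⁻ p))

      ⋁⁺ : ∀ {bs} → Any Y bs → Y (⋁ bs)
      ⋁⁺ (here p)  = ∨⁺ (inj₁ p)
      ⋁⁺ (there p) = ∨⁺ (inj₂ (⋁⁺ p))

      ⋁⁻ : ∀ bs → Y (⋁ bs) → Any Y bs
      ⋁⁻ []       p = ⊥-elim (0∉ p)
      ⋁⁻ (b ∷ bs) p with ∨⁻ p
      ... | inj₁ q = here q
      ... | inj₂ q = there (⋁⁻ bs q)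

  abstract
    -- Every point `x` outside `O` satisfies `x ≰ y`, so a basic set contains `y` and omits `x`.
    -- Compactness of the complement of `O` leaves finitely many such sets, and their meet is the
    -- witness.
    down-basis : ∀ {O y} → Open O → DownSet poset O → y ∈ O → ∃[ b ] (y ∈ ⟦ b ⟧ × ⟦ b ⟧ ⊆ O)
    down-basis {O} {y} oO dO y∈O =
      let (bs , cover) = compact-closed (closed-∁ oO) {Σ[ b ∈ ∣B∣ ] y ∈ ⟦ b ⟧}
            (λ (b , _) → ∁ ⟦ b ⟧) (λ (b , _) → proj₂ (clopen b))
            (λ x x∉O → let (b , y∈b , x∉b) = separates (λ x≤y → x∉O (dO x≤y y∈O)) in
                       (b , y∈b) , x∉b)
      in ⋀ (map proj₁ bs) , ⋀⁺ (prime y) (Allₚ.map⁺ (All.universal proj₂ bs)) ,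
         λ {x} x∈b → by-contradiction λ x∉O →
           Any¬⇒¬All (cover x x∉O) (Allₚ.map⁻ (⋀⁻ (prime x) (map proj₁ bs) x∈b))

    up-basis : ∀ {O y} → Open O → UpSet poset O → y ∈ O → ∃[ b ] (y ∉ ⟦ b ⟧ × ∁ ⟦ b ⟧ ⊆ O)
    up-basis {O} {y} oO uO y∈O =
      let (bs , cover) = compact-closed (closed-∁ oO) {Σ[ b ∈ ∣B∣ ] y ∉ ⟦ b ⟧}
            (λ (b , _) → ⟦ b ⟧) (λ (b , _) → proj₁ (clopen b))
            (λ x x∉O → let (b , x∈b , y∉b) = separates (λ y≤x → x∉O (uO y≤x y∈O)) in
                       (b , y∉b) , x∈b)
      in ⋁ (map proj₁ bs) ,
         (λ y∈ → All¬⇒¬Any (All.universal proj₂ bs) (Anyₚ.map⁻ (⋁⁻ (prime y) (map proj₁ bs) y∈))) ,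
         λ {x} x∉b → by-contradiction λ x∉O → x∉b (⋁⁺ (prime x) (Anyₚ.map⁺ (cover x x∉O)))

    -- An open down-set is a union of basic sets; being closed, hence compact, it is a finite union,
    -- and joins represent those.
    clopen-down-set : ∀ {U} → Clopen U → DownSet poset U → ∃[ b ] ⟦ b ⟧ ≐ U
    clopen-down-set {U} (oU , cU) dU =
      let (bs , cover) = compact-closed cU {Σ[ b ∈ ∣B∣ ] ⟦ b ⟧ ⊆ U}
            (λ (b , _) → ⟦ b ⟧) (λ (b , _) → proj₁ (clopen b))
            (λ x x∈U → let (b , x∈b , b⊆U) = down-basis oU dU x∈U in (b , b⊆U) , x∈b)
      in ⋁ (map proj₁ bs) ,
         (λ {x} x∈ → let ((_ , b⊆U) , x∈b) = Any.satisfied (Anyₚ.map⁻ (⋁⁻ (prime x) (map proj₁ bs) x∈))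
                     in b⊆U x∈b) ,
         λ {x} x∈U → ⋁⁺ (prime x) (Anyₚ.map⁺ (cover x x∈U))

  module _ {Y : Pred ∣B∣ ℓ} (Y-prime : IsPrime Y) where
    open IsPrime Y-prime

    -- The requirements on a point that realises `Y`: to lie in `⟦ b ⟧` for `b` in `Y`, and outside
    -- `⟦ c ⟧` for `c` not in `Y`. Each carries its proof, so that a finite list of them can be
    -- merged into one pair.
    Member : Set ℓ
    Member = (Σ[ b ∈ ∣B∣ ] Y b) ⊎ (Σ[ c ∈ ∣B∣ ] ¬ Y c)

    Fails : Member → Pred Carrier ℓ
    Fails (inj₁ (b , _)) = ∁ ⟦ b ⟧
    Fails (inj₂ (c , _)) = ⟦ c ⟧

    abstract
      fails-open : ∀ m → Open (Fails m)
      fails-open (inj₁ (b , _)) = proj₂ (clopen b)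
      fails-open (inj₂ (c , _)) = proj₁ (clopen c)

      conjunction : ∀ ms → ∃[ b ] ∃[ c ] (Y b × ¬ Y c ×
                    (∀ x → x ∈ ⟦ b ⟧ → x ∉ ⟦ c ⟧ → ¬ Any (λ m → x ∈ Fails m) ms))
      conjunction [] = 1# , 0# , 1∈ , 0∉ , λ _ _ _ ()
      conjunction (inj₁ (b′ , Yb′) ∷ ms) = let (b , c , Yb , ¬Yc , h) = conjunction ms in
        b′ ∧ b , c , ∧⁺ Yb′ Yb , ¬Yc , λ x x∈ x∉ → let (p , q) = Prime.∧⁻ x x∈ in
          λ { (here n) → n p ; (there r) → h x q x∉ r }
      conjunction (inj₂ (c′ , ¬Yc′) ∷ ms) = let (b , c , Yb , ¬Yc , h) = conjunction ms in
        b , c′ ∨ c , Yb , [ ¬Yc′ , ¬Yc ]′ ∘ ∨⁻ , λ x x∈ x∉ →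
          λ { (here n) → x∉ (Prime.∨⁺ x (inj₁ n)) ; (there r) → h x x∈ (x∉ ∘ Prime.∨⁺ x ∘ inj₂) r }

      -- If no point met all requirements, the open sets `Fails m` would cover the space. A finite
      -- subcover merges into `b` in `Y` and `c` outside `Y` with `⟦ b ⟧ ⊆ ⟦ c ⟧`, hence `b ≤ c`,
      -- against upward closure of `Y`.
      realised : (∀ {b c} → ⟦ b ⟧ ⊆ ⟦ c ⟧ → b ≤ᴮ c) → ∃[ x ] ((λ b → x ∈ ⟦ b ⟧) ≐ Y)
      realised faithful = by-contradiction λ none →
        let (ms , cover) = compact Fails fails-open λ x → by-contradiction λ n →
              none (x , (λ {b} x∈b → by-contradiction λ ¬Yb → n (inj₂ (b , ¬Yb) , x∈b)) ,
                        (λ {b} Yb → by-contradiction λ x∉b → n (inj₁ (b , Yb) , x∉b)))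
            (b , c , Yb , ¬Yc , h) = conjunction ms
        in ¬Yc (up (faithful λ {x} x∈b → by-contradiction λ x∉c → h x x∈b x∉c (cover x)) Yb)

  abstract
    -- By antisymmetry, any point outside `O` fails a requirement imposed by the prime filter of
    -- `y`; compactness makes finitely many requirements enough.
    basis : ∀ {O y} → Open O → y ∈ O →
            ∃[ b ] ∃[ c ] (y ∈ ⟦ b ⟧ × y ∉ ⟦ c ⟧ × (∀ x → x ∈ ⟦ b ⟧ → x ∉ ⟦ c ⟧ → x ∈ O))
    basis {O} {y} oO y∈O =
      let (ms , cover) = compact-closed (closed-∁ oO) (Fails (prime y)) (fails-open (prime y)) failing
          (b , c , y∈b , y∉c , h) = conjunction (prime y) ms
      in b , c , y∈b , y∉c , λ x x∈b x∉c → by-contradiction λ x∉O → h x x∈b x∉c (cover x x∉O)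
      where
      failing : ∀ x → x ∉ O → ∃[ m ] x ∈ Fails (prime y) m
      failing x x∉O with em {P = x ≤ y}
      ... | no x≰y = let (b , y∈b , x∉b) = separates x≰y in inj₁ (b , y∈b) , x∉b
      ... | yes x≤y = let (c , x∈c , y∉c) = separates y≰x in inj₂ (c , y∉c) , x∈c
        where
        y≰x : ¬ (y ≤ x)
        y≰x y≤x = x∉O (Topology.resp-≈ topology oO (antisym y≤x x≤y) y∈O)

-- The operations on prime filters that make the spectrum a ⊖-space.

module SpectrumSpace (em : ∀ {a} → ExcludedMiddle a) (ext : ∀ {a b} → Extensionality a b) (ℓ : Level)
                     (A : ⊖-Algebra ℓ) where
  open Classical em ℓ
  open Spectrum em ext ℓ A
  open ⊖-Algebra A using (Carrier; _≈_; _∧_; _∨_; _⊖_; 0#; 1#)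
  private
    module A = ⊖-Algebra A

  module Difference (x : Point) where
    open Point x

    abstract
      ⊖-resp : ∀ {a b c d} → a ≈ c → b ≈ d → x ∋ a ⊖ b → x ∋ c ⊖ d
      ⊖-resp p q = resp (A.⊖-cong p q)

      ∧⊖⁺ : ∀ {a b c} → x ∋ a ⊖ c → x ∋ b ⊖ c → x ∋ (a ∧ b) ⊖ c
      ∧⊖⁺ p q = resp (A.sym (A.∧-⊖ _ _ _)) (∧⁺ p q)

      ∧⊖⁻ : ∀ {a b c} → x ∋ (a ∧ b) ⊖ c → x ∋ a ⊖ c × x ∋ b ⊖ c
      ∧⊖⁻ p = ∧⁻ (resp (A.∧-⊖ _ _ _) p)

      ∨⊖⁺ : ∀ {a b c} → x ∋ a ⊖ c ⊎ x ∋ b ⊖ c → x ∋ (a ∨ b) ⊖ c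
      ∨⊖⁺ p = resp (A.sym (A.∨-⊖ _ _ _)) (∨⁺ p)

      ∨⊖⁻ : ∀ {a b c} → x ∋ (a ∨ b) ⊖ c → x ∋ a ⊖ c ⊎ x ∋ b ⊖ c
      ∨⊖⁻ p = ∨⁻ (resp (A.∨-⊖ _ _ _) p)

      ⊖∧⁺ : ∀ {a b c} → x ∋ a ⊖ b ⊎ x ∋ a ⊖ c → x ∋ a ⊖ (b ∧ c)
      ⊖∧⁺ p = resp (A.sym (A.⊖-∧ _ _ _)) (∨⁺ p)

      ⊖∧⁻ : ∀ {a b c} → x ∋ a ⊖ (b ∧ c) → x ∋ a ⊖ b ⊎ x ∋ a ⊖ c
      ⊖∧⁻ p = ∨⁻ (resp (A.⊖-∧ _ _ _) p)

      ⊖∨⁺ : ∀ {a b c} → x ∋ a ⊖ b → x ∋ a ⊖ c → x ∋ a ⊖ (b ∨ c)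
      ⊖∨⁺ p q = resp (A.sym (A.⊖-∨ _ _ _)) (∧⁺ p q)

      ⊖∨⁻ : ∀ {a b c} → x ∋ a ⊖ (b ∨ c) → x ∋ a ⊖ b × x ∋ a ⊖ c
      ⊖∨⁻ p = ∧⁻ (resp (A.⊖-∨ _ _ _) p)

      0⊖∉ : ∀ {b} → ¬ x ∋ 0# ⊖ b
      0⊖∉ p = 0∉ (resp (A.0-⊖ _) p)

      ⊖1∉ : ∀ {a} → ¬ x ∋ a ⊖ 1#
      ⊖1∉ p = 0∉ (resp (A.⊖-1 _) p)

      ⊖0⁺ : ∀ {a} → x ∋ a → x ∋ a ⊖ 0#
      ⊖0⁺ = resp (A.sym (A.⊖-0 _))

      -- From `b = 0 ∨ b` follows `a ⊖ b = (a ⊖ 0) ∧ (a ⊖ b)`, which lies below `a ⊖ 0 = a`.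
      ⊖⇒∋ : ∀ {a b} → x ∋ a ⊖ b → x ∋ a
      ⊖⇒∋ p = resp (A.⊖-0 _) (proj₁ (⊖∨⁻ (⊖-resp A.refl (A.sym (proj₁ A.∨-identity _)) p)))

      ⊖⇒1⊖ : ∀ {a b} → x ∋ a ⊖ b → x ∋ 1# ⊖ b
      ⊖⇒1⊖ p = proj₁ (∧⊖⁻ (⊖-resp (A.sym (proj₁ A.∧-identity _)) A.refl p))

      -- The prime filters {a ∣ a ⊖ b ∈ x} and {a ∣ a ⊖ b′ ∈ x} are comparable.
      ⊖-exchange : ∀ {a b b′ c} → x ∋ a ⊖ b′ → ¬ x ∋ a ⊖ b → x ∋ c ⊖ b → x ∋ c ⊖ b′
      ⊖-exchange p n q with ⊖∧⁻ (∧⊖⁺ (⊖∧⁺ (inj₂ p)) (⊖∧⁺ (inj₁ q)))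
      ... | inj₁ r = contradiction (proj₁ (∧⊖⁻ r)) n
      ... | inj₂ r = proj₂ (∧⊖⁻ r)

  open Difference

  abstract
    i-prime : ∀ x → IsPrime (λ a → ¬ x ∋ 1# ⊖ a)
    i-prime x = record
      { resp = λ e n p → n (⊖-resp x A.refl (A.sym e) p)
      ; ∧⁺   = λ m n p → [ m , n ]′ (⊖∧⁻ x p)
      ; ∧⁻   = λ n → n ∘ ⊖∧⁺ x ∘ inj₁ , n ∘ ⊖∧⁺ x ∘ inj₂
      ; ∨⁺   = λ { (inj₁ n) p → n (proj₁ (⊖∨⁻ x p)) ; (inj₂ n) p → n (proj₂ (⊖∨⁻ x p)) }
      ; ∨⁻   = ∨-split
      ; 1∈   = ⊖1∉ x
      ; 0∉   = λ n → n (⊖0⁺ x (Point.1∈ x))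
      }
      where
      ∨-split : ∀ {a b} → ¬ x ∋ 1# ⊖ (a ∨ b) → ¬ x ∋ 1# ⊖ a ⊎ ¬ x ∋ 1# ⊖ b
      ∨-split {a} n with em {P = x ∋ 1# ⊖ a}
      ... | yes p = inj₂ λ q → n (⊖∨⁺ x p q)
      ... | no ¬p = inj₁ ¬p

  i : Point → Point
  i x = point (i-prime x)

  abstract
    i∋⁻ : ∀ x {a} → i x ∋ a → ¬ x ∋ 1# ⊖ a
    i∋⁻ _ = reflect

    i∌⁻ : ∀ x {a} → ¬ i x ∋ a → x ∋ 1# ⊖ a
    i∌⁻ _ n = by-contradiction (n ∘ reify)

    i-antitone : ∀ x y → x ≤ᵖ y → i y ≤ᵖ i x
    i-antitone x y x≤y a a∈ = reify (i∋⁻ x a∈ ∘ x≤y _)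

  abstract
    -- For `∨⁻`, failures at `b` and at `c` combine at `b ∨ c`, which stays outside `y` because `y`
    -- is prime. The domain condition `y ≤ i x` says exactly that 1 is a member.
    sum-prime : ∀ x y → y ≤ᵖ i x → IsPrime (λ a → ∀ b → ¬ y ∋ b → x ∋ a ⊖ b)
    sum-prime x y y≤ix = record
      { resp = λ e p b b∉ → ⊖-resp x e A.refl (p b b∉)
      ; ∧⁺   = λ p q b b∉ → ∧⊖⁺ x (p b b∉) (q b b∉)
      ; ∧⁻   = λ p → (λ b b∉ → proj₁ (∧⊖⁻ x (p b b∉))) , (λ b b∉ → proj₂ (∧⊖⁻ x (p b b∉)))
      ; ∨⁺   = λ { (inj₁ p) b b∉ → ∨⊖⁺ x (inj₁ (p b b∉)) ; (inj₂ p) b b∉ → ∨⊖⁺ x (inj₂ (p b b∉)) }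
      ; ∨⁻   = λ p → by-contradiction λ n →
          n (inj₁ λ b b∉ → by-contradiction λ ¬p →
            n (inj₂ λ c c∉ → by-contradiction λ ¬q →
              [ ¬p ∘ proj₁ ∘ ⊖∨⁻ x , ¬q ∘ proj₂ ∘ ⊖∨⁻ x ]′
                (∨⊖⁻ x (p (b ∨ c) ([ b∉ , c∉ ]′ ∘ Point.∨⁻ y)))))
      ; 1∈   = λ b b∉ → by-contradiction λ n → b∉ (y≤ix b (reify n))
      ; 0∉   = λ p → 0⊖∉ x (p 0# (Point.0∉ y))
      }

  sum : ∀ x y → y ≤ᵖ i x → Point
  sum x y y≤ix = point (sum-prime x y y≤ix)

  abstract
    star-prime : ∀ x y → ¬ (i x ≤ᵖ y) → IsPrime (λ a → ∃[ b ] (y ∋ b × x ∋ a ⊖ b))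
    star-prime x y ix≰y = record
      { resp = λ e (b , b∈ , p) → b , b∈ , ⊖-resp x e A.refl p
      ; ∧⁺   = λ (b , b∈ , p) (c , c∈ , q) → b ∧ c , Point.∧⁺ y b∈ c∈ ,
                 ∧⊖⁺ x (⊖∧⁺ x (inj₁ p)) (⊖∧⁺ x (inj₂ q))
      ; ∧⁻   = λ (b , b∈ , p) → (b , b∈ , proj₁ (∧⊖⁻ x p)) , (b , b∈ , proj₂ (∧⊖⁻ x p))
      ; ∨⁺   = λ { (inj₁ (b , b∈ , p)) → b , b∈ , ∨⊖⁺ x (inj₁ p)
                 ; (inj₂ (b , b∈ , p)) → b , b∈ , ∨⊖⁺ x (inj₂ p) }
      ; ∨⁻   = λ (b , b∈ , p) → [ (λ q → inj₁ (b , b∈ , q)) , (λ q → inj₂ (b , b∈ , q)) ]′ (∨⊖⁻ x p)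
      ; 1∈   = let (b , b∈ , b∉) = ≰ᵖ⇒ {i x} {y} ix≰y in b , b∈ , i∌⁻ x b∉
      ; 0∉   = λ (_ , _ , p) → 0⊖∉ x p
      }

  star : ∀ x y → ¬ (i x ≤ᵖ y) → Point
  star x y ix≰y = point (star-prime x y ix≰y)

  abstract
    star∋⁻ : ∀ x y {a} (p : ¬ (i x ≤ᵖ y)) → star x y p ∋ a → ∃[ b ] (y ∋ b × x ∋ a ⊖ b)
    star∋⁻ _ _ _ = reflect

  -- Weak enough for three uses: a prime filter above `x` in the order, giving the upper adjoint;
  -- the filter of all `c` with `c ⊖ b ∈ x`; and the filter generated by the image of a prime filter
  -- under a homomorphism.
  record IsFilterWithin (x : Point) (Z : Pred Carrier ℓ) : Set ℓ where
    field
      Z-∧ : ∀ {a b} → Z a → Z b → Z (a ∧ b)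
      Z-1 : Z 1#
      Z⊆x : ∀ {a} → Z a → x ∋ a

  abstract
    -- Primeness comes from `x` and the laws of `⊖`; from `Z` only closure under meets, the element
    -- 1 and inclusion in `x` enter.
    residual-prime : ∀ x {Z} → IsFilterWithin x Z → IsPrime (λ b → ∃[ a ] (Z a × ¬ x ∋ a ⊖ b))
    residual-prime x {Z} filter = record
      { resp = λ e (a , a∈ , n) → a , a∈ , n ∘ ⊖-resp x A.refl (A.sym e)
      ; ∧⁺   = λ (a , a∈ , m) (b , b∈ , n) → a ∧ b , Z-∧ a∈ b∈ ,
                 [ m ∘ proj₁ ∘ ∧⊖⁻ x , n ∘ proj₂ ∘ ∧⊖⁻ x ]′ ∘ ⊖∧⁻ x
      ; ∧⁻   = λ (a , a∈ , n) → (a , a∈ , n ∘ ⊖∧⁺ x ∘ inj₁) , (a , a∈ , n ∘ ⊖∧⁺ x ∘ inj₂)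
      ; ∨⁺   = λ { (inj₁ (a , a∈ , n)) → a , a∈ , n ∘ proj₁ ∘ ⊖∨⁻ x
                 ; (inj₂ (a , a∈ , n)) → a , a∈ , n ∘ proj₂ ∘ ⊖∨⁻ x }
      ; ∨⁻   = λ (a , a∈ , n) → by-contradiction λ m →
          m (inj₁ (a , a∈ , λ p → m (inj₂ (a , a∈ , λ q → n (⊖∨⁺ x p q)))))
      ; 1∈   = 1# , Z-1 , ⊖1∉ x
      ; 0∉   = λ (a , a∈ , n) → n (⊖0⁺ x (Z⊆x a∈))
      } where open IsFilterWithin filter

  -- The largest w with Z ⊆ x + w.
  residual : ∀ x {Z} → IsFilterWithin x Z → Point
  residual x filter = point (residual-prime x filter)

  abstract
    residual∋⁻ : ∀ x {Z} (filter : IsFilterWithin x Z) {b} → residual x filter ∋ b →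
                 ∃[ a ] (Z a × ¬ x ∋ a ⊖ b)
    residual∋⁻ _ _ = reflect

    residual≤i : ∀ x {Z} (filter : IsFilterWithin x Z) → residual x filter ≤ᵖ i x
    residual≤i x filter a a∈ = reify (1# , IsFilterWithin.Z-1 filter , i∋⁻ x a∈)

    sum-residual : ∀ x {Z} (filter : IsFilterWithin x Z) {a} → Z a →
                   sum x (residual x filter) (residual≤i x filter) ∋ a
    sum-residual x filter a∈ = reify λ b b∉ → by-contradiction λ n → b∉ (reify (_ , a∈ , n))

    -- If a ⊖ b ∈ x, then the largest w with {c ∣ c ⊖ b ∈ x} ⊆ x + w omits b.
    ⊖⇒sum : ∀ x {a b} → x ∋ a ⊖ b → ∃[ w ] Σ[ p ∈ w ≤ᵖ i x ] (¬ w ∋ b × sum x w p ∋ a)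
    ⊖⇒sum x {a} {b} a⊖b = residual x filter , residual≤i x filter ,
      (λ b∈ → let (_ , p , n) = residual∋⁻ x filter b∈ in n p) , sum-residual x filter a⊖b
      where
      filter : IsFilterWithin x (λ c → x ∋ c ⊖ b)
      filter = record { Z-∧ = ∧⊖⁺ x ; Z-1 = ⊖⇒1⊖ x a⊖b ; Z⊆x = ⊖⇒∋ x }

    sum⇒⊖ : ∀ x w {a b} (p : w ≤ᵖ i x) → ¬ w ∋ b → sum x w p ∋ a → x ∋ a ⊖ b
    sum⇒⊖ _ _ p b∉ a∈ = reflect a∈ _ b∉

    sum∌⁻ : ∀ x w {a} (p : w ≤ᵖ i x) → ¬ sum x w p ∋ a → ∃[ b ] (¬ w ∋ b × ¬ x ∋ a ⊖ b)
    sum∌⁻ _ _ p a∉ = by-contradiction λ none →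
      a∉ (reify λ b b∉ → by-contradiction λ n → none (b , b∉ , n))

    sum-increasing : ∀ {x w} (p : w ≤ᵖ i x) → x ≤ᵖ sum x w p
    sum-increasing {x} {w} p a a∈ = ⊖⇒∋ x (sum⇒⊖ x w p (Point.0∉ w) a∈)

    sum-mono : ∀ x x′ y y′ (p : y ≤ᵖ i x) (q : y′ ≤ᵖ i x′) → x ≤ᵖ x′ → y ≤ᵖ y′ →
               sum x y p ≤ᵖ sum x′ y′ q
    sum-mono x x′ y y′ p q x≤x′ y≤y′ a a∈ = reify λ b b∉ →
      x≤x′ _ (sum⇒⊖ x′ y′ q (b∉ ∘ y≤y′ b) a∈)

    sum-total : ∀ {x v w} (p : v ≤ᵖ i x) (q : w ≤ᵖ i x) →
                sum x v p ≤ᵖ sum x w q ⊎ sum x w q ≤ᵖ sum x v p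
    sum-total {x} {v} {w} p q with em {P = sum x v p ≤ᵖ sum x w q}
    ... | yes v≤w = inj₁ v≤w
    ... | no  v≰w = inj₂ λ c c∈ → reify λ b′ b′∉ → by-contradiction λ n →
      let (a , a∈ , a∉) = ≰ᵖ⇒ {sum x v p} {sum x w q} v≰w
      in a∉ (reify λ b b∉ → by-contradiction λ m →
           n (⊖-exchange x (sum⇒⊖ x w q b′∉ a∈) m (sum⇒⊖ x v p b∉ c∈)))

  open Basis em ext ℓ pointSpace A (λ a x → x ∋ a) Point.isPrime ∋-clopen
    (λ a x≤y → x≤y a) (λ {x} {y} → ≰ᵖ⇒ {x} {y}) public

  private
    module X = PriestleySpace pointSpace
    module τ = Topology X.topology

  abstract
    i-continuous : Continuous X.topology X.topology i
    i-continuous (lift o) = lift λ x ix∈U → let (a , b , a∈ , b∉ , sub) = o (i x) ix∈U in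
      1# ⊖ b , 1# ⊖ a , i∌⁻ x b∉ , i∋⁻ x a∈ ,
      λ y p q → sub (i y) (reify q) λ b∈ → i∋⁻ y b∈ p

    -- If `b ∉ y`, then `a ⊖ b ∉ x` forces `a ∉ x + y`. So a pair `a`, `b` cuts out a rectangle of
    -- open up-sets whose sums omit `a`, and `up-basis` finds an `a` whose omission forces
    -- membership in `U`.
    sum-continuous : Continuous (subspaceTopology (productTopology X.τ↑ X.τ↑) (λ (x , y) → y ≤ᵖ i x))
                                X.τ↑ (λ ((x , y) , p) → sum x y p)
    sum-continuous {U} (oU , upU) = W ,
      (λ (x , y) (a , b , n , m , sub) →
        (λ x′ → ¬ x′ ∋ a ⊖ b) , (λ y′ → ¬ y′ ∋ b) ,
        ((proj₂ (∋-clopen (a ⊖ b))) , λ x≤y k → k ∘ x≤y _) ,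
        ((proj₂ (∋-clopen b)) , λ x≤y k → k ∘ x≤y _) ,
        (n , m) , λ (n′ , m′) → a , b , n′ , m′ , sub) ,
      (λ {((x , y) , p)} s∈U → let (a , a∉ , sub) = up-basis oU upU s∈U
                                   (b , b∉ , n) = sum∌⁻ x y p a∉
                               in a , b , n , b∉ , λ z z∌ → sub z∌) ,
      (λ {((x , y) , p)} (a , b , n , m , sub) → sub (sum x y p) λ a∈ → n (sum⇒⊖ x y p m a∈))
      where
      W : Pred (Point × Point) ℓ
      W (x , y) = ∃[ a ] ∃[ b ] (¬ x ∋ a ⊖ b × ¬ y ∋ b × (∀ z → ¬ z ∋ a → z ∈ U))

    star-continuous : Continuous (subspaceTopology (productTopology X.τ↓ X.τ↓) (λ (x , y) → ¬ (i x ≤ᵖ y)))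
                                 X.τ↓ (λ ((x , y) , p) → star x y p)
    star-continuous {U} (oU , dU) = W ,
      (λ (x , y) (a , b , p , q , sub) →
        (_∋ a ⊖ b) , (_∋ b) ,
        (proj₁ (∋-clopen (a ⊖ b)) , λ x≤y → x≤y _) ,
        (proj₁ (∋-clopen b) , λ x≤y → x≤y _) ,
        (p , q) , λ (p′ , q′) → a , b , p′ , q′ , sub) ,
      (λ {((x , y) , p)} s∈U → let (a , a∈ , sub) = down-basis oU dU s∈U
                                   (b , b∈ , q) = reflect a∈
                               in a , b , q , b∈ , λ z z∋ → sub z∋) ,
      (λ {((x , y) , p)} (a , b , q , b∈ , sub) → sub (star x y p) (reify (b , b∈ , q)))
      where
      W : Pred (Point × Point) ℓ
      W (x , y) = ∃[ a ] ∃[ b ] (x ∋ a ⊖ b × y ∋ b × (∀ z → z ∋ a → z ∈ U))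

    filter : ∀ x z → x ≤ᵖ z → IsFilterWithin x (z ∋_)
    filter _ z x≤z = record { Z-∧ = Point.∧⁺ z ; Z-1 = Point.1∈ z ; Z⊆x = x≤z _ }

    star-monoˡ : ∀ x x′ y (p : ¬ (i x ≤ᵖ y)) (q : ¬ (i x′ ≤ᵖ y)) → x ≤ᵖ x′ →
                 star x y p ≤ᵖ star x′ y q
    star-monoˡ x x′ y p q x≤x′ a a∈ = let (b , b∈ , r) = star∋⁻ x′ y q a∈ in
      reify (b , b∈ , x≤x′ _ r)

    star-monoʳ : ∀ x y y′ (p : ¬ (i x ≤ᵖ y)) (q : ¬ (i x ≤ᵖ y′)) → y ≤ᵖ y′ →
                 star x y p ≤ᵖ star x y′ q
    star-monoʳ x y y′ p q y≤y′ a a∈ = let (b , b∈ , r) = star∋⁻ x y′ q a∈ in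
      reify (b , y≤y′ b b∈ , r)

    -- Under reverse inclusion a lower bound contains the union of the filters. If `a ⊖ b ∈ x` with
    -- `b ∈ y`, then `⊖⇒sum` gives `w` omitting `b`, hence `w ≰ y`, with `a ∈ x + w`.
    star-infimum : ∀ x y (p : ¬ (i x ≤ᵖ y)) → IsInfimum pointPoset
      (λ u → ∃[ w ] Σ[ q ∈ w ≤ᵖ i x ] (¬ (w ≤ᵖ y) × u ≈ᵖ sum x w q)) (star x y p)
    star-infimum x y p =
      (λ (w , q , w≰y , _ , s≤u) a u∋a →
        let (b , b∈ , b∉) = ≰ᵖ⇒ {w} {y} w≰y
        in reify (b , b∈ , sum⇒⊖ x w q b∉ (s≤u a u∋a))) ,
      λ v lower a a∈ → let (b , b∈ , r) = star∋⁻ x y p a∈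
                           (w , q , b∉ , s∋a) = ⊖⇒sum x r
                       in lower {sum x w q} (w , q , (λ w≤y → b∉ (w≤y b b∈)) , X.Eq.refl {sum x w q}) a s∋a

    sum-adjoint : ∀ x w z (p : w ≤ᵖ i x) (x≤z : x ≤ᵖ z) →
                  sum x w p ≤ᵖ z ⇔ w ≤ᵖ residual x (filter x z x≤z)
    sum-adjoint x w z p x≤z = mk⇔
      (λ s≤z b b∈ → let (a , a∈ , n) = residual∋⁻ x (filter x z x≤z) b∈ in
        by-contradiction λ b∉ → n (sum⇒⊖ x w p b∉ (s≤z a a∈)))
      (λ w≤ a a∈ → reify λ b b∉ → by-contradiction λ n → b∉ (w≤ b (reify (a , a∈ , n))))

  space : ⊖-Space ℓ
  space .⊖-Space.priestleySpace = pointSpace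
  space .⊖-Space.i = i
  space .⊖-Space.i-continuous = i-continuous
  space .⊖-Space.i-antitone {x} {y} = i-antitone x y
  space .⊖-Space.plus ((x , y) , p) = sum x y p
  space .⊖-Space.star ((x , y) , p) = star x y p
  space .⊖-Space.+-upperContinuous = sum-continuous
  space .⊖-Space.⋆-lowerContinuous = star-continuous
  space .⊖-Space.+-monoˡ {x} {x′} {y} p q x≤x′ = sum-mono x x′ y y p q x≤x′ λ _ b∈ → b∈
  space .⊖-Space.+-monoʳ {x} {y} {y′} p q = sum-mono x x y y′ p q λ _ a∈ → a∈
  space .⊖-Space.⋆-monoˡ {x} {x′} {y} = star-monoˡ x x′ y
  space .⊖-Space.⋆-monoʳ {x} {y} {y′} = star-monoʳ x y y′
  space .⊖-Space.⋆-infimum {x} {y} = star-infimum x y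
  space .⊖-Space.+-increasing {x} {w} = sum-increasing {x} {w}
  space .⊖-Space.L-chain x (v , p) (w , q) = sum-total {x} {v} {w} p q
  space .⊖-Space.L-adjoint x =
    (λ (z , x≤z) → residual x (filter x z x≤z) , residual≤i x (filter x z x≤z)) ,
    λ (w , p) (z , x≤z) → sum-adjoint x w z p x≤z

-- The difference of clopen down-sets in a ⊖-space is clopen.

module SpaceDifference (em : ∀ {a} → ExcludedMiddle a) (ℓ : Level) (X : ⊖-Space ℓ) where
  open Classical em ℓ
  open ⊖-Space X
  open Priestley em ℓ priestleySpace
  private
    module τ = Topology topology

  res : ∀ x z → x ≤ z → Carrier
  res x z p = proj₁ (proj₁ (L-adjoint x) (z , p))

  abstract
    res≤i : ∀ {x z} (p : x ≤ z) → res x z p ≤ i x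
    res≤i p = proj₂ (proj₁ (L-adjoint _) (_ , p))

    +-res : ∀ {x z} (p : x ≤ z) → x + res x z p [ res≤i p ] ≤ z
    +-res p = ⇔.from (proj₂ (L-adjoint _) _ (_ , p)) refl

    res-greatest : ∀ {x z w} (p : x ≤ z) (q : w ≤ i x) → x + w [ q ] ≤ z → w ≤ res x z p
    res-greatest p q = ⇔.to (proj₂ (L-adjoint _) (_ , q) (_ , p))

  Diff : Pred Carrier ℓ → Pred Carrier ℓ → Pred Carrier ℓ
  Diff U V x = ∃[ w ] Σ[ q ∈ w ≤ i x ] (¬ V w × U (x + w [ q ]))

  -- The description of Diff U V through ⋆, which makes it open.
  StarDiff : Pred Carrier ℓ → Pred Carrier ℓ → Pred Carrier ℓ
  StarDiff U V x = U x × (∀ y → V y → Σ[ p ∈ ¬ (i x ≤ y) ] U (x ⋆ y [ p ]))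

  abstract
    -- `e₀` is the answer for the empty list. The order is a parameter because the reversed order is
    -- also needed, to find a largest value.
    least : ∀ {I E : Set ℓ} {_⊑_ : E → E → Set ℓ} → (∀ {a b c} → a ⊑ b → b ⊑ c → a ⊑ c) →
            (∀ {a} → a ⊑ a) → (∀ a b → a ⊑ b ⊎ b ⊑ a) → (e : I → E) → E → ∀ is →
            ∃[ m ] All (λ i → m ⊑ e i) is
    least tr rf tot e e₀ [] = e₀ , []
    least tr rf tot e e₀ (i ∷ is) with least tr rf tot e e₀ is
    ... | m , ms with tot m (e i)
    ...   | inj₁ m⊑ = m , m⊑ ∷ ms
    ...   | inj₂ ⊑m = e i , rf ∷ All.map (tr ⊑m) ms

  module _ {U V : Pred Carrier ℓ} (dU : DownSet poset U) where

    abstract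
      diff-down : DownSet poset (Diff U V)
      diff-down x≤y (w , q , w∉V , u) =
        let r = trans q (i-antitone x≤y) in w , r , w∉V , dU (+-monoˡ r q x≤y) u

      diff-closed : Clopen U → Open V → Closed (Diff U V)
      diff-closed (_ , cU) oV = open-local λ x x∉ →
        let (O , oO , x∈O , h) = tube (closed-∁ oV) (local x x∉)
        in O , oO , x∈O , λ x′∈O (w , q , w∉V , u) → h x′∈O w∉V q u
        where
        local : ∀ x → x ∉ Diff U V → ∀ k → k ∉ V →
                ∃[ O ] ∃[ P ] (Open O × Open P × x ∈ O × k ∈ P ×
                  (∀ {x′ k′} → x′ ∈ O → k′ ∈ P → (q : k′ ≤ i x′) → ¬ U (x′ + k′ [ q ])))
        local x x∉ k k∉V with em {P = k ≤ i x}
        -- Where `+` is undefined at `(x , k)`, separation keeps a whole rectangle outside its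
        -- domain.
        ... | no k≰ix = let (D , (oD , cD) , dD , ix∈D , k∉D) = separation k≰ix in
          (i ⊢ D) , ∁ D , i-continuous oD , cD , ix∈D , k∉D ,
          λ ix′∈D k′∉D q _ → k′∉D (dD q ix′∈D)
        ... | yes q =
          let (W , oW , ⊆W , W⊆) = +-upperContinuous (cU , ∁-upSet {U} dU)
              (O , P , (oO , _) , (oP , _) , (x∈O , k∈P) , sub) =
                oW (x , k) (⊆W {(x , k) , q} λ u → x∉ (k , q , k∉V , u))
          in O , P , oO , oP , x∈O , k∈P , λ x′∈O k′∈P q′ → W⊆ {_ , q′} (sub (x′∈O , k′∈P))

      starDiff-open : Open U → Closed V → Open (StarDiff U V)
      starDiff-open oU cV = open-local λ x (u , us) →
        let (O , oO , x∈O , h) = tube cV (local x us)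
        in U ∩ O , τ.inter oU oO , (u , x∈O) , λ (u′ , x′∈O) → u′ , λ y y∈V → h x′∈O y∈V
        where
        local : ∀ x → (∀ y → V y → Σ[ p ∈ ¬ (i x ≤ y) ] U (x ⋆ y [ p ])) → ∀ k → k ∈ V →
                ∃[ O ] ∃[ P ] (Open O × Open P × x ∈ O × k ∈ P ×
                  (∀ {x′ k′} → x′ ∈ O → k′ ∈ P → Σ[ p ∈ ¬ (i x′ ≤ k′) ] U (x′ ⋆ k′ [ p ])))
        local x us k k∈V =
          let (p , u) = us k k∈V
              (D , (oD , cD) , dD , k∈D , ix∉D) = separation p
              (W , oW , ⊆W , W⊆) = ⋆-lowerContinuous {U} (oU , dU)
              (O , P , (oO , _) , (oP , _) , (x∈O , k∈P) , sub) = oW (x , k) (⊆W {(x , k) , p} u)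
          -- `W` constrains only pairs inside the domain of `⋆`; intersecting with `D` and with the
          -- preimage of its complement forces the pairs into that domain.
          in O ∩ (i ⊢ ∁ D) , P ∩ D , τ.inter oO (i-continuous cD) , τ.inter oP oD ,
             (x∈O , ix∉D) , (k∈P , k∈D) , λ (x′∈O , ix′∉D) (k′∈P , k′∈D) →
               let p′ = λ ix′≤k′ → ix′∉D (dD ix′≤k′ k′∈D) in p′ , W⊆ {_ , p′} (sub (x′∈O , k′∈P))

      diff⊆starDiff : DownSet poset V → Diff U V ⊆ StarDiff U V
      diff⊆starDiff dV (w , q , w∉V , u) = dU (+-increasing q) u , λ y y∈V →
        let p = λ ix≤y → w∉V (dV (trans q ix≤y) y∈V)
        in p , dU (proj₁ (⋆-infimum p) (w , q , (λ w≤y → w∉V (dV w≤y y∈V)) , Eq.refl)) u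

      -- By compactness, the infimum x ⋆ y of the chain of all x + w with w ≰ y
      -- lies in the clopen set U only if some x + w does.
      star⇒sum : Clopen U → ∀ {x y} (p : ¬ (i x ≤ y)) → U (x ⋆ y [ p ]) →
                 ∃[ w ] Σ[ q ∈ w ≤ i x ] (¬ (w ≤ y) × U (x + w [ q ]))
      star⇒sum (oU , cU) {x} {y} p u = by-contradiction λ none →
        -- A point outside the down-set `U` is not below `x ⋆ y`, hence is not a lower bound of the
        -- values.
        let missed : ∀ k → ¬ U k → ∃[ e ] ¬ (k ≤ value e)
            missed k k∉U = by-contradiction λ n → k∉U (dU (proj₂ (⋆-infimum p) k
              λ (w , q , w≰y , u≈) → trans (by-contradiction λ k≰ → n ((w , q , w≰y) , k≰))
                                           (reflexive (Eq.sym u≈))) u)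
            apart = λ ((k , k∉U) : ∃ (∁ U)) → separation (proj₂ (missed k k∉U))
            (ks , cover) = compact-closed (closed-∁ oU) {∃ (∁ U)}
              (λ k → ∁ (proj₁ (apart k)))
              (λ k → let (_ , (_ , cD) , _) = apart k in cD)
              (λ k k∉U → (k , k∉U) , (let (_ , _ , _ , _ , k∉D) = apart (k , k∉U) in k∉D))
            ((w , q , w≰y) , below) = least {_⊑_ = λ d e → value d ≤ value e} trans refl
              (λ (v , r , _) (w , s , _) → L-chain x (v , r) (w , s))
              -- The default summand is `i x`, admissible because `p` states `i x ≰ y`.
              (λ (k , k∉U) → proj₁ (missed k k∉U)) (i x , refl , p) ks
        in Any¬⇒¬All (cover _ λ u′ → none (w , q , w≰y , u′))
             (All.map (λ {k} ≤k → let (_ , _ , dD , s∈D , _) = apart k in dD ≤k s∈D) below)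
        where
        Summand : Set ℓ
        Summand = ∃[ w ] (w ≤ i x × ¬ (w ≤ y))

        value : Summand → Carrier
        value (w , q , _) = x + w [ q ]

      -- Each `y` in `V` has a summand `w ≰ y` with `x + w` in `U`, and a clopen down-set that
      -- contains `y` and omits `w`; finitely many of these cover `V`. Let `z` be the largest of the
      -- corresponding sums. The residual of `z` lies above every chosen `w`, so it avoids all the
      -- covering down-sets and hence `V`.
      starDiff⊆diff : Clopen U → Clopen V → StarDiff U V ⊆ Diff U V
      starDiff⊆diff clU (_ , cV) {x} (x∈U , us) =
        let summand = λ ((y , y∈V) : ∃ V) → let (p , u) = us y y∈V in star⇒sum clU p u
            apart = λ (y : ∃ V) → let (_ , _ , w≰y , _) = summand y in separation w≰y
            (ys , cover) = compact-closed cV {∃ V} (λ y → proj₁ (apart y))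
              (λ y → let (_ , (oD , _) , _) = apart y in oD)
              (λ y y∈V → (y , y∈V) , (let (_ , _ , _ , y∈D , _) = apart (y , y∈V) in y∈D))
            ((m , r , m∈U) , above) = least {_⊑_ = λ d e → value e ≤ value d}
              (λ p q → trans q p) refl (λ (v , r , _) (w , s , _) → L-chain x (w , s) (v , r))
              (λ y → let (w , q , _ , u) = summand y in w , q , u)
              -- The default, for an empty subcover: `x + res x x ≤ x`, and `x` is in `U`.
              (res x x refl , res≤i refl , dU (+-res refl) x∈U) ys
            z = +-increasing r
        in res x _ z , res≤i z ,
           (λ w∈V → All¬⇒¬Any
             (All.map (λ {y} y≤ w∈D → let (_ , _ , dD , _ , w∉D) = apart y
                                          (_ , q , _) = summand y
                                      in w∉D (dD (res-greatest z q y≤) w∈D)) above)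
             (cover _ w∈V)) ,
           dU (+-res z) m∈U
        where
        Summand : Set ℓ
        Summand = ∃[ w ] Σ[ q ∈ w ≤ i x ] U (x + w [ q ])

        value : Summand → Carrier
        value (w , q , _) = x + w [ q ]

      diff-clopen : Clopen U → Clopen V → DownSet poset V → Clopen (Diff U V)
      diff-clopen clU clV dV =
        τ.resp-≐ (starDiff⊆diff clU clV , diff⊆starDiff dV) (starDiff-open (proj₁ clU) (proj₂ clV)) ,
        diff-closed clU (proj₁ clV)

-- The ⊖-algebra of clopen down-sets.

module ClopenDownSets (em : ∀ {a} → ExcludedMiddle a) (ext : ∀ {a b} → Extensionality a b) (ℓ : Level)
                      (X : ⊖-Space ℓ) where
  open Classical em ℓ
  open ⊖-Space X
  open Priestley em ℓ priestleySpace
  open SpaceDifference em ℓ X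
  private
    module τ = Topology topology

  -- Being clopen is a type one level above ℓ, while the carrier of the algebra must lie at ℓ; a
  -- Boolean certificate brings it down.
  record ClopenDown : Set ℓ where
    no-eta-equality
    field
      mem          : Carrier → Bool
      isClopenDown : Holds ⌜ (Clopen (Holds ∘ mem) × DownSet poset (Holds ∘ mem)) ⌝

  infix 4 _∋_
  _∋_ : ClopenDown → Carrier → Set ℓ
  U ∋ x = Holds (ClopenDown.mem U x)

  abstract
    clopen : ∀ U → Clopen (U ∋_)
    clopen U = proj₁ (reflect (ClopenDown.isClopenDown U))

    down : ∀ U → DownSet poset (U ∋_)
    down U = proj₂ (reflect (ClopenDown.isClopenDown U))

    coded-clopen-down : ∀ {P : Pred Carrier ℓ} → Clopen P → DownSet poset P →
      Holds ⌜ (Clopen (λ x → Holds ⌜ P x ⌝) × DownSet poset (λ x → Holds ⌜ P x ⌝)) ⌝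
    coded-clopen-down (oP , cP) dP = reify
      ((τ.resp-≐ (reify , reflect) oP , τ.resp-≐ (_∘ reflect , _∘ reify) cP) ,
       λ x≤y y∈ → reify (dP x≤y (reflect y∈)))

  code : ∀ {P} → Clopen P → DownSet poset P → ClopenDown
  code {P} clP dP = record { mem = λ x → ⌜ P x ⌝ ; isClopenDown = coded-clopen-down clP dP }

  abstract
    whole-clopen : Clopen (λ _ → ⊤)
    whole-clopen = τ.whole , τ.resp-≐ ((λ ()) , λ n → contradiction tt n) open-∅

    ∅-clopen : Clopen (λ _ → Empty.⊥)
    ∅-clopen = open-∅ , τ.resp-≐ ((λ _ ()) , _) τ.whole

    ∩-down : ∀ U V → DownSet poset (λ x → U ∋ x × V ∋ x)
    ∩-down U V x≤y (u , v) = down U x≤y u , down V x≤y v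

    ∪-down : ∀ U V → DownSet poset (λ x → U ∋ x ⊎ V ∋ x)
    ∪-down U V x≤y (inj₁ u) = inj₁ (down U x≤y u)
    ∪-down U V x≤y (inj₂ v) = inj₂ (down V x≤y v)

  _∧_ _∨_ _⊖_ : ClopenDown → ClopenDown → ClopenDown
  U ∧ V = code {λ x → U ∋ x × V ∋ x} (clopen-∩ (clopen U) (clopen V)) (∩-down U V)
  U ∨ V = code {λ x → U ∋ x ⊎ V ∋ x} (clopen-∪ (clopen U) (clopen V)) (∪-down U V)
  U ⊖ V = code {Diff (U ∋_) (V ∋_)}
            (diff-clopen (down U) (clopen U) (clopen V) (down V)) (diff-down (down U))

  1# 0# : ClopenDown
  1# = code {λ _ → ⊤} whole-clopen _
  0# = code {λ _ → Empty.⊥} ∅-clopen λ _ ()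

  abstract
    ∧⁻ : ∀ U V {x} → U ∧ V ∋ x → U ∋ x × V ∋ x
    ∧⁻ _ _ = reflect

    ∨⁻ : ∀ U V {x} → U ∨ V ∋ x → U ∋ x ⊎ V ∋ x
    ∨⁻ _ _ = reflect

    ⊖⁻ : ∀ U V {x} → U ⊖ V ∋ x → Diff (U ∋_) (V ∋_) x
    ⊖⁻ _ _ = reflect

    0⁻ : ¬ Holds ⌜ Empty.⊥ {ℓ} ⌝
    0⁻ = Empty.⊥-elim ∘ reflect {P = Empty.⊥ {ℓ}}

  infix 4 _≈ᵁ_
  _≈ᵁ_ : ClopenDown → ClopenDown → Set ℓ
  U ≈ᵁ V = (U ∋_) ≐ (V ∋_)

  abstract
    isDistributiveLattice : IsDistributiveLattice _≈ᵁ_ _∨_ _∧_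
    isDistributiveLattice =
      LatticeMonomorphism.isDistributiveLattice monomorphism
        (UnaryAlgebra.∪-∩-isDistributiveLattice Carrier ℓ)
      where
      monomorphism : IsLatticeMonomorphism
        (record { _≈_ = _≈ᵁ_ ; _∧_ = _∧_ ; _∨_ = _∨_ })
        (record { _≈_ = _≐_ {A = Carrier} {ℓ} {ℓ} ; _∧_ = _∩_ ; _∨_ = _∪_ }) _∋_
      monomorphism = record
        { isLatticeHomomorphism = record
          { isRelHomomorphism = record { cong = λ e → e }
          ; ∧-homo = λ U V → ∧⁻ U V , reify
          ; ∨-homo = λ U V → ∨⁻ U V , reify
          }
        ; injective = λ e → e
        }

    -- The largest summand with value at most `x + m` lies above both `w` and `w′`. Complements of
    -- down-sets are up-sets, so it avoids `V` and `V′` at once.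
    ⊖-∨-upper : ∀ U V V′ {x m w w′} (r : m ≤ i x) → U ∋ x + m [ r ] →
                w ≤ res x _ (+-increasing r) → ¬ V ∋ w →
                w′ ≤ res x _ (+-increasing r) → ¬ V′ ∋ w′ →
                Diff (U ∋_) (V ∨ V′ ∋_) x
    ⊖-∨-upper U V V′ r u w≤ n w′≤ n′ = res _ _ (+-increasing r) , res≤i _ ,
      [ n ∘ down V w≤ , n′ ∘ down V′ w′≤ ]′ ∘ ∨⁻ V V′ , down U (+-res _) u

    ∨-identity : (∀ U → 0# ∨ U ≈ᵁ U) × (∀ U → U ∨ 0# ≈ᵁ U)
    ∨-identity =
      (λ U → (λ p → [ (λ z → contradiction z 0⁻) , (λ u → u) ]′ (∨⁻ 0# U p)) , reify ∘ inj₂) ,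
      (λ U → (λ p → [ (λ u → u) , (λ z → contradiction z 0⁻) ]′ (∨⁻ U 0# p)) , reify ∘ inj₁)

    ∧-identity : (∀ U → 1# ∧ U ≈ᵁ U) × (∀ U → U ∧ 1# ≈ᵁ U)
    ∧-identity = (λ U → proj₂ ∘ ∧⁻ 1# U , λ u → reify (reify tt , u)) ,
                 (λ U → proj₁ ∘ ∧⁻ U 1# , λ u → reify (u , reify tt))

    ⊖-cong : ∀ {U U′ V V′} → U ≈ᵁ U′ → V ≈ᵁ V′ → U ⊖ V ≈ᵁ U′ ⊖ V′
    ⊖-cong {U} {U′} {V} {V′} (U⊆U′ , U′⊆U) (V⊆V′ , V′⊆V) =
      (λ p → let (w , q , n , u) = ⊖⁻ U V p in reify (w , q , n ∘ V′⊆V , U⊆U′ u)) ,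
      (λ p → let (w , q , n , u) = ⊖⁻ U′ V′ p in reify (w , q , n ∘ V⊆V′ , U′⊆U u))

    ∧-⊖ : ∀ U U′ V → (U ∧ U′) ⊖ V ≈ᵁ (U ⊖ V) ∧ (U′ ⊖ V)
    ∧-⊖ U U′ V =
      (λ p → let (w , q , n , u) = ⊖⁻ (U ∧ U′) V p
                 (u₁ , u₂) = ∧⁻ U U′ u
             in reify (reify (w , q , n , u₁) , reify (w , q , n , u₂))) ,
      λ p → let (p₁ , p₂) = ∧⁻ (U ⊖ V) (U′ ⊖ V) p
                (w , q , n , u) = ⊖⁻ U V p₁
                (w′ , q′ , n′ , u′) = ⊖⁻ U′ V p₂
            -- The smaller of the two sums lies in both down-sets.
            in case L-chain _ (w , q) (w′ , q′) of λ
              { (inj₁ w≤w′) → reify (w , q , n , reify (u , down U′ w≤w′ u′))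
              ; (inj₂ w′≤w) → reify (w′ , q′ , n′ , reify (down U w′≤w u , u′)) }

    ∨-⊖ : ∀ U U′ V → (U ∨ U′) ⊖ V ≈ᵁ (U ⊖ V) ∨ (U′ ⊖ V)
    ∨-⊖ U U′ V =
      (λ p → let (w , q , n , u) = ⊖⁻ (U ∨ U′) V p in
        reify ([ (λ u → inj₁ (reify (w , q , n , u))) , (λ u → inj₂ (reify (w , q , n , u))) ]′
               (∨⁻ U U′ u))) ,
      λ p → case ∨⁻ (U ⊖ V) (U′ ⊖ V) p of λ
        { (inj₁ r) → let (w , q , n , u) = ⊖⁻ U V r in reify (w , q , n , reify (inj₁ u))
        ; (inj₂ r) → let (w , q , n , u) = ⊖⁻ U′ V r in reify (w , q , n , reify (inj₂ u)) }

    ⊖-∧ : ∀ U V V′ → U ⊖ (V ∧ V′) ≈ᵁ (U ⊖ V) ∨ (U ⊖ V′)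
    ⊖-∧ U V V′ =
      (λ p → let (w , q , n , u) = ⊖⁻ U (V ∧ V′) p in by-contradiction λ m →
        m (reify (inj₁ (reify (w , q , (λ v →
        m (reify (inj₂ (reify (w , q , (λ v′ → n (reify (v , v′))) , u))))) , u))))) ,
      λ p → case ∨⁻ (U ⊖ V) (U ⊖ V′) p of λ
        { (inj₁ r) → let (w , q , n , u) = ⊖⁻ U V r in reify (w , q , n ∘ proj₁ ∘ ∧⁻ V V′ , u)
        ; (inj₂ r) → let (w , q , n , u) = ⊖⁻ U V′ r in reify (w , q , n ∘ proj₂ ∘ ∧⁻ V V′ , u) }

    ⊖-∨ : ∀ U V V′ → U ⊖ (V ∨ V′) ≈ᵁ (U ⊖ V) ∧ (U ⊖ V′)
    ⊖-∨ U V V′ =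
      (λ p → let (w , q , n , u) = ⊖⁻ U (V ∨ V′) p in
        reify (reify (w , q , n ∘ reify ∘ inj₁ , u) , reify (w , q , n ∘ reify ∘ inj₂ , u))) ,
      λ p → let (p₁ , p₂) = ∧⁻ (U ⊖ V) (U ⊖ V′) p
                (w , q , n , u) = ⊖⁻ U V p₁
                (w′ , q′ , n′ , u′) = ⊖⁻ U V′ p₂
            in reify (case L-chain _ (w , q) (w′ , q′) of λ
              { (inj₁ w≤w′) → ⊖-∨-upper U V V′ q′ u′ (res-greatest _ q w≤w′) n
                                (res-greatest _ q′ refl) n′
              ; (inj₂ w′≤w) → ⊖-∨-upper U V V′ q u (res-greatest _ q refl) n
                                (res-greatest _ q′ w′≤w) n′ })

    0-⊖ : ∀ U → 0# ⊖ U ≈ᵁ 0#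
    0-⊖ U = (λ p → let (_ , _ , _ , z) = ⊖⁻ 0# U p in contradiction z 0⁻) ,
            (λ z → contradiction z 0⁻)

    ⊖-1 : ∀ U → U ⊖ 1# ≈ᵁ 0#
    ⊖-1 U = (λ p → let (_ , _ , n , _) = ⊖⁻ U 1# p in contradiction (reify tt) n) ,
            (λ z → contradiction z 0⁻)

    ⊖-0 : ∀ U → U ⊖ 0# ≈ᵁ U
    ⊖-0 U = (λ p → let (w , q , _ , u) = ⊖⁻ U 0# p in down U (+-increasing q) u) ,
            -- The upper adjoint at `x` itself supplies a summand with `x + w ≤ x`.
            (λ u → reify (res _ _ refl , res≤i refl , 0⁻ , down U (+-res refl) u))

  algebra : ⊖-Algebra ℓ
  algebra .⊖-Algebra.Carrier = ClopenDown
  algebra .⊖-Algebra._≈_ = _≈ᵁ_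
  algebra .⊖-Algebra._∨_ = _∨_
  algebra .⊖-Algebra._∧_ = _∧_
  algebra .⊖-Algebra.0# = 0#
  algebra .⊖-Algebra.1# = 1#
  algebra .⊖-Algebra._⊖_ = _⊖_
  algebra .⊖-Algebra.isDistributiveLattice = isDistributiveLattice
  algebra .⊖-Algebra.∨-identity = ∨-identity
  algebra .⊖-Algebra.∧-identity = ∧-identity
  algebra .⊖-Algebra.⊖-cong {U} {U′} {V} {V′} = ⊖-cong {U} {U′} {V} {V′}
  algebra .⊖-Algebra.∧-⊖ = ∧-⊖
  algebra .⊖-Algebra.∨-⊖ = ∨-⊖
  algebra .⊖-Algebra.⊖-∧ = ⊖-∧
  algebra .⊖-Algebra.⊖-∨ = ⊖-∨
  algebra .⊖-Algebra.0-⊖ = 0-⊖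
  algebra .⊖-Algebra.⊖-1 = ⊖-1
  algebra .⊖-Algebra.⊖-0 = ⊖-0

  open Spectrum em ext ℓ algebra using (IsPrime) renaming (_≤_ to _≤ᵁ_)

  abstract
    membership-prime : ∀ x → IsPrime (_∋ x)
    membership-prime x = record
      { resp = λ (U⊆V , _) → U⊆V
      ; ∧⁺   = λ p q → reify (p , q)
      ; ∧⁻   = λ {U} {V} → ∧⁻ U V
      ; ∨⁺   = reify
      ; ∨⁻   = λ {U} {V} → ∨⁻ U V
      ; 1∈   = reify tt
      ; 0∉   = 0⁻
      }

    ⊆⇒≤ : ∀ U V → (U ∋_) ⊆ (V ∋_) → U ≤ᵁ V
    ⊆⇒≤ U V U⊆V = (λ u → reify (u , U⊆V u)) , proj₁ ∘ ∧⁻ U V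

    separates : ∀ {x y} → ¬ (x ≤ y) → ∃[ U ] (U ∋ y × ¬ U ∋ x)
    separates x≰y = let (D , clD , dD , y∈D , x∉D) = separation x≰y in
      code {D} clD dD , reify y∈D , x∉D ∘ reflect

  open Basis em ext ℓ priestleySpace algebra _∋_ membership-prime clopen down separates public

-- The morphism of spectra dual to a homomorphism.

module Comap (em : ∀ {a} → ExcludedMiddle a) (ext : ∀ {a b} → Extensionality a b) (ℓ : Level)
             {A B : ⊖-Algebra ℓ} (h : ⊖-Hom A B) where
  open Classical em ℓ
  open ⊖-Hom h
  private
    module A where
      open ⊖-Algebra A public
      open Spectrum em ext ℓ A public
      open SpectrumSpace em ext ℓ A public
    module B where
      open ⊖-Algebra B public
      open Spectrum em ext ℓ B public
      open SpectrumSpace em ext ℓ B public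

  comap : B.Point → A.Point
  comap x = A.point {λ a → x B.∋ ⟦ a ⟧} record
    { resp = λ e → resp (⟦⟧-cong e)
    ; ∧⁺   = λ p q → resp (B.sym (∧-homo _ _)) (∧⁺ p q)
    ; ∧⁻   = λ p → ∧⁻ (resp (∧-homo _ _) p)
    ; ∨⁺   = λ p → resp (B.sym (∨-homo _ _)) (∨⁺ p)
    ; ∨⁻   = λ p → ∨⁻ (resp (∨-homo _ _) p)
    ; 1∈   = resp (B.sym 1-homo) 1∈
    ; 0∉   = λ p → 0∉ (resp 0-homo p)
    } where open B.Point x

  comap⁻ : ∀ x {a} → comap x A.∋ a → x B.∋ ⟦ a ⟧
  comap⁻ _ = reflect

  comap-⊖⁺ : ∀ x {a b} → x B.∋ ⟦ a ⟧ B.⊖ ⟦ b ⟧ → comap x A.∋ a A.⊖ b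
  comap-⊖⁺ x p = reify (B.Point.resp x (B.sym (⊖-homo _ _)) p)

  comap-⊖⁻ : ∀ x {a b} → comap x A.∋ a A.⊖ b → x B.∋ ⟦ a ⟧ B.⊖ ⟦ b ⟧
  comap-⊖⁻ x p = B.Point.resp x (⊖-homo _ _) (comap⁻ x p)

  1⊖-homo : ∀ b → ⟦ A.1# ⟧ B.⊖ b B.≈ B.1# B.⊖ b
  1⊖-homo b = B.⊖-cong 1-homo B.refl

  comap-i≤ : ∀ x → comap (B.i x) A.≤ᵖ A.i (comap x)
  comap-i≤ x a a∈ = reify (reify λ p →
    A.i∋⁻ (comap x) a∈ (comap-⊖⁺ x (B.Point.resp x (B.sym (1⊖-homo _)) p)))

  i≤comap-i : ∀ x → A.i (comap x) A.≤ᵖ comap (B.i x)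
  i≤comap-i x a a∈ = reify λ p →
    B.i∋⁻ x (comap⁻ (B.i x) a∈) (B.Point.resp x (1⊖-homo _) (comap-⊖⁻ x p))

  comap-mono : ∀ {x y} → x B.≤ᵖ y → comap x A.≤ᵖ comap y
  comap-mono {x} {y} x≤y a p = reify (x≤y ⟦ a ⟧ (comap⁻ y p))

  comap-sum : ∀ x y p q → A.sum (comap x) (comap y) q A.≤ᵖ comap (B.sum x y p)
  comap-sum x y p q a a∈ = reify λ b b∉ →
    comap-⊖⁺ x (B.sum⇒⊖ x y p (b∉ ∘ reify) (comap⁻ (B.sum x y p) a∈))

  module Back (x : B.Point) (z : A.Point) (q : z A.≤ᵖ A.i (comap x)) where

    -- The filter generated by the image of comap x + z.
    Generated : Pred B.Carrier ℓ
    Generated c = ∃[ a ] (A.sum (comap x) z q A.∋ a × c B.≈ ⟦ a ⟧)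

    filter : B.IsFilterWithin x Generated
    filter = record
      { Z-∧ = λ (a , a∈ , e) (b , b∈ , e′) → a A.∧ b ,
                A.Point.∧⁺ (A.sum (comap x) z q) a∈ b∈ ,
                B.trans (B.∧-cong e e′) (B.sym (∧-homo a b))
      ; Z-1 = A.1# , A.Point.1∈ (A.sum (comap x) z q) , B.sym 1-homo
      ; Z⊆x = λ (a , a∈ , e) → B.Point.resp x (B.sym e)
                (comap⁻ x (A.sum-increasing {comap x} {z} q a a∈))
      }

    -- The largest `w` such that `x + w` contains the image of `comap x + z`. Its maximality gives
    -- `z ≤ comap w`, and monotonicity of `+` then gives the remaining inequality between the sums.
    w : B.Point
    w = B.residual x filter

    w≤i : w B.≤ᵖ B.i x
    w≤i = B.residual≤i x filter

    z≤w : z A.≤ᵖ comap w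
    z≤w b b∈ = by-contradiction λ b∉ →
      let (c , (a , a∈ , e) , n) = B.residual∋⁻ x filter (comap⁻ w b∈)
      in n (B.Difference.⊖-resp x (B.sym e) B.refl (comap-⊖⁻ x (A.sum⇒⊖ (comap x) z q b∉ a∈)))

    w≤ix : comap w A.≤ᵖ A.i (comap x)
    w≤ix a a∈ = comap-mono {w} {B.i x} w≤i a (comap-i≤ x a a∈)

    sum-w≤ : comap (B.sum x w w≤i) A.≤ᵖ A.sum (comap x) z q
    sum-w≤ a a∈ = reify (B.sum-residual x filter (a , a∈ , B.refl))

    ≤sum-w : A.sum (comap x) z q A.≤ᵖ comap (B.sum x w w≤i)
    ≤sum-w a a∈ = A.sum-mono (comap x) (comap x) z (comap w) q w≤ix (λ _ p → p) z≤w a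
      (comap-sum x w w≤i w≤ix a a∈)

  comapMap : ⊖-Map (SpectrumSpace.space em ext ℓ B) (SpectrumSpace.space em ext ℓ A)
  comapMap = record
    { ⟦_⟧        = comap
    ; continuous = λ { (lift o) → lift λ x fx∈U → let (a , b , a∈ , b∉ , sub) = o (comap x) fx∈U in
                       ⟦ a ⟧ , ⟦ b ⟧ , comap⁻ x a∈ , b∉ ∘ reify ,
                       λ y p n → sub (comap y) (reify p) (n ∘ comap⁻ y) }
    ; mono       = λ {x} {y} → comap-mono {x} {y}
    ; i-homo     = λ x → comap-i≤ x , i≤comap-i x
    ; +-forth    = comap-sum
    ; +-back     = λ x z q → let open Back x z q in w , w≤i , z≤w , sum-w≤ , ≤sum-w
    }

-- The homomorphism of clopen down-sets dual to a morphism.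

module Preimage (em : ∀ {a} → ExcludedMiddle a) (ext : ∀ {a b} → Extensionality a b) (ℓ : Level)
                {X Y : ⊖-Space ℓ} (f : ⊖-Map X Y) where
  open Classical em ℓ
  open ⊖-Map f
  private
    module X where
      open ⊖-Space X public
      open ClopenDownSets em ext ℓ X public
    module Y where
      open ⊖-Space Y public
      open ClopenDownSets em ext ℓ Y public

  preimage : Y.ClopenDown → X.ClopenDown
  preimage U = X.code {λ x → U Y.∋ ⟦ x ⟧}
    (continuous (proj₁ (Y.clopen U)) , continuous (proj₂ (Y.clopen U)))
    λ x≤y → Y.down U (mono x≤y)

  preimage⁻ : ∀ U {x} → preimage U X.∋ x → U Y.∋ ⟦ x ⟧
  preimage⁻ _ = reflect

  hom : ⊖-Hom (ClopenDownSets.algebra em ext ℓ Y) (ClopenDownSets.algebra em ext ℓ X)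
  hom = record
    { ⟦_⟧ = preimage
    ; isLatticeHomomorphism = record
      { isRelHomomorphism = record
        { cong = λ {U} {V} (U⊆V , V⊆U) →
            (λ p → reify (U⊆V (preimage⁻ U p))) , (λ p → reify (V⊆U (preimage⁻ V p))) }
      ; ∧-homo = λ U V →
          (λ p → let (u , v) = Y.∧⁻ U V (preimage⁻ (U Y.∧ V) p) in reify (reify u , reify v)) ,
          (λ p → let (u , v) = X.∧⁻ (preimage U) (preimage V) p in
                 reify (reify (preimage⁻ U u , preimage⁻ V v)))
      ; ∨-homo = λ U V →
          (λ p → reify ([ inj₁ ∘ reify , inj₂ ∘ reify ]′ (Y.∨⁻ U V (preimage⁻ (U Y.∨ V) p)))) ,
          (λ p → reify (reify ([ inj₁ ∘ preimage⁻ U , inj₂ ∘ preimage⁻ V ]′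
                                (X.∨⁻ (preimage U) (preimage V) p))))
      }
    ; 0-homo = (λ {x} p → contradiction (preimage⁻ Y.0# {x} p) Y.0⁻) , λ p → contradiction p X.0⁻
    ; 1-homo = (λ _ → reify tt) , (λ _ → reify (reify tt))
    -- The two conditions on morphisms match the two inclusions: `+-back` gives the first, `+-forth`
    -- the second.
    ; ⊖-homo = λ U V →
        (λ {x} p → let (z , q , z∉V , u)      = Y.⊖⁻ U V (preimage⁻ (U Y.⊖ V) p)
                       (w , r , z≤w , fsum≈) = +-back x z q
                   in reify (w , r , (λ w∈ → z∉V (Y.down V z≤w (preimage⁻ V w∈))) ,
                             reify (Y.down U (Y.reflexive fsum≈) u))) ,
        (λ {x} p → let (w , q , w∉ , u) = X.⊖⁻ (preimage U) (preimage V) p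
                       r = Y.trans (mono q) (Y.reflexive (i-homo x))
                   in reify (reify (⟦ w ⟧ , r , w∉ ∘ reify ,
                                    Y.down U (+-forth x w q r) (preimage⁻ U u))))
    }

-- The isomorphism between an algebra and its double dual.

module _ {ℓ : Level} {A B : ⊖-Algebra ℓ} (h : ⊖-Hom A B) where
  open ⊖-Hom h
  private
    module A = ⊖-Algebra A
    module B = ⊖-Algebra B

  inverseHom : (∀ a b → ⟦ a ⟧ B.≈ ⟦ b ⟧ → a A.≈ b) → (∀ b → ∃[ a ] ⟦ a ⟧ B.≈ b) → ⊖-Hom B A
  inverseHom injective surjective = record
    { ⟦_⟧ = g
    ; isLatticeHomomorphism = record
      { isRelHomomorphism = record
        { cong = λ e → injective _ _ (B.trans (hg _) (B.trans e (B.sym (hg _)))) }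
      ; ∧-homo = λ b c → injective _ _ (B.trans (hg _)
                   (B.sym (B.trans (∧-homo _ _) (B.∧-cong (hg b) (hg c)))))
      ; ∨-homo = λ b c → injective _ _ (B.trans (hg _)
                   (B.sym (B.trans (∨-homo _ _) (B.∨-cong (hg b) (hg c)))))
      }
    ; 0-homo = injective _ _ (B.trans (hg _) (B.sym 0-homo))
    ; 1-homo = injective _ _ (B.trans (hg _) (B.sym 1-homo))
    ; ⊖-homo = λ b c → injective _ _ (B.trans (hg _)
                 (B.sym (B.trans (⊖-homo _ _) (B.⊖-cong (hg b) (hg c)))))
    }
    where
    g : B.Carrier → A.Carrier
    g b = proj₁ (surjective b)

    hg : ∀ b → ⟦ g b ⟧ B.≈ b
    hg b = proj₂ (surjective b)

module AlgebraUnit (em : ∀ {a} → ExcludedMiddle a) (ext : ∀ {a b} → Extensionality a b) (ℓ : Level)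
                   (A : ⊖-Algebra ℓ) where
  open Classical em ℓ
  open Spectrum em ext ℓ A
  open SpectrumSpace em ext ℓ A
  private
    module A = ⊖-Algebra A
    module C = ClopenDownSets em ext ℓ (SpectrumSpace.space em ext ℓ A)

  basic : A.Carrier → C.ClopenDown
  basic a = C.code {_∋ a} (∋-clopen a) λ x≤y → x≤y a

  basic⁻ : ∀ a {x} → basic a C.∋ x → x ∋ a
  basic⁻ _ = reflect

  hom : ⊖-Hom A (ClopenDownSets.algebra em ext ℓ (SpectrumSpace.space em ext ℓ A))
  hom = record
    { ⟦_⟧ = basic
    ; isLatticeHomomorphism = record
      { isRelHomomorphism = record
        { cong = λ {a} {b} e → (λ {x} p → reify (Point.resp x e (basic⁻ a {x} p))) ,
                               (λ {x} p → reify (Point.resp x (A.sym e) (basic⁻ b {x} p))) }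
      ; ∧-homo = λ a b →
          (λ {x} p → let (q , r) = Point.∧⁻ x (basic⁻ (a A.∧ b) {x} p) in reify (reify q , reify r)) ,
          (λ {x} p → let (q , r) = C.∧⁻ (basic a) (basic b) {x} p in
                     reify (Point.∧⁺ x (basic⁻ a {x} q) (basic⁻ b {x} r)))
      ; ∨-homo = λ a b →
          (λ {x} p → reify ([ inj₁ ∘ reify , inj₂ ∘ reify ]′ (Point.∨⁻ x (basic⁻ (a A.∨ b) {x} p)))) ,
          (λ {x} p → reify (Point.∨⁺ x ([ inj₁ ∘ basic⁻ a {x} , inj₂ ∘ basic⁻ b {x} ]′
                                          (C.∨⁻ (basic a) (basic b) {x} p))))
      }
    ; 0-homo = (λ {x} p → contradiction (basic⁻ A.0# {x} p) (Point.0∉ x)) , λ p → contradiction p C.0⁻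
    ; 1-homo = (λ _ → reify tt) , λ {x} _ → reify (Point.1∈ x)
    ; ⊖-homo = λ a b →
        (λ {x} p → let (w , q , b∉ , a∈) = ⊖⇒sum x (basic⁻ (a A.⊖ b) {x} p) in
                   reify (w , q , b∉ ∘ basic⁻ b {w} , reify a∈)) ,
        (λ {x} p → let (w , q , b∉ , a∈) = C.⊖⁻ (basic a) (basic b) {x} p in
                   reify (sum⇒⊖ x w q (b∉ ∘ reify) (basic⁻ a {sum x w q} a∈)))
    }

  ⊆⇒≤ : ∀ a b → (basic a C.∋_) ⊆ (basic b C.∋_) → a ≤ b
  ⊆⇒≤ a b sub = by-contradiction λ a≰b → let (x , a∈ , b∉) = prime-filter-theorem a≰b in
    b∉ (basic⁻ b {x} (sub {x} (reify a∈)))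

  injective : ∀ a b → basic a C.≈ᵁ basic b → a A.≈ b
  injective a b (p , q) = antisym (⊆⇒≤ a b λ {x} → p {x}) (⊆⇒≤ b a λ {x} → q {x})

  surjective : ∀ U → ∃[ a ] basic a C.≈ᵁ U
  surjective U = let (a , ⊆U , U⊆) = clopen-down-set (C.clopen U) (C.down U) in
    a , (λ {x} p → ⊆U (basic⁻ a {x} p)) , reify ∘ U⊆

-- The isomorphism between a ⊖-space and its double dual.

module SpaceUnit (em : ∀ {a} → ExcludedMiddle a) (ext : ∀ {a b} → Extensionality a b) (ℓ : Level)
                 (X : ⊖-Space ℓ) where
  open Classical em ℓ
  open ⊖-Space X
  open ClopenDownSets em ext ℓ X hiding (_∧_; _∨_)
  private
    module S where
      open Spectrum em ext ℓ (ClopenDownSets.algebra em ext ℓ X) public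
      open SpectrumSpace em ext ℓ (ClopenDownSets.algebra em ext ℓ X) public
    module τ = Topology topology

  ε : Carrier → S.Point
  ε x = S.point (membership-prime x)

  ε⁻ : ∀ x U → ε x S.∋ U → U ∋ x
  ε⁻ _ _ = reflect

  ε-mono : ∀ x y → x ≤ y → ε x S.≤ᵖ ε y
  ε-mono x y x≤y U p = reify (down U x≤y (ε⁻ y U p))

  ε-reflects : ∀ x y → ε x S.≤ᵖ ε y → x ≤ y
  ε-reflects x y εx≤εy = by-contradiction λ x≰y → let (U , y∈ , x∉) = separates x≰y in
    x∉ (ε⁻ x U (εx≤εy U (reify y∈)))

  ε-i≤ : ∀ x → ε (i x) S.≤ᵖ S.i (ε x)
  -- If `i x ∉ U`, then `i x` itself is a summand witnessing that `x` lies in `1# ⊖ U`.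
  ε-i≤ x U p = reify (by-contradiction λ n → S.i∋⁻ (ε x) {U} p
    (reify (reify (i x , refl , n , reify tt))))

  i≤ε-i : ∀ x → S.i (ε x) S.≤ᵖ ε (i x)
  i≤ε-i x U p = reify λ r → let (w , q , w∉ , _) = ⊖⁻ 1# U (ε⁻ x (1# ⊖ U) r) in
    w∉ (down U q (ε⁻ (i x) U p))

  sum≤ε : ∀ x y (p : y ≤ i x) (q : ε y S.≤ᵖ S.i (ε x)) → S.sum (ε x) (ε y) q S.≤ᵖ ε (x + y [ p ])
  sum≤ε x y p q U u = reify λ V y∉ → reify (reify (y , p , y∉ ∘ reify , ε⁻ (x + y [ p ]) U u))

  -- Rests on upper continuity. If `x + y ∉ U`, some open up-set `P` around `y` has all its defined
  -- sums with `x` outside `U`, and `P` contains the complement of a clopen down-set `V` omitting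
  -- `y`. But `x ∈ U ⊖ V` provides `w ∉ V` with `x + w ∈ U`.
  ε≤sum : ∀ x y (p : y ≤ i x) (q : ε y S.≤ᵖ S.i (ε x)) → ε (x + y [ p ]) S.≤ᵖ S.sum (ε x) (ε y) q
  ε≤sum x y p q U s = reify (by-contradiction λ u∉ →
    let (W , oW , ⊆W , W⊆) =
          +-upperContinuous (proj₂ (clopen U) , λ x≤y x∉ y∈ → x∉ (down U x≤y y∈))
        (O , P , _ , (oP , uP) , (x∈O , y∈P) , sub) = oW (x , y) (⊆W {(x , y) , p} u∉)
        (V , y∉V , V⊆P) = up-basis oP uP y∈P
        (w , r , w∉V , u) = ⊖⁻ U V (ε⁻ x (U ⊖ V) (S.sum⇒⊖ (ε x) (ε y) {U} {V} q (y∉V ∘ ε⁻ y V) s))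
    in W⊆ {(x , w) , r} (sub (x∈O , V⊆P w∉V)) u)

  ε-continuous : Continuous topology S.pointTopology ε
  ε-continuous (lift o) = open-local λ x εx∈ →
    let (U , V , u , v , sub) = o (ε x) εx∈ in
    (λ y → U ∋ y × ¬ V ∋ y) , τ.inter (proj₁ (clopen U)) (proj₂ (clopen V)) ,
    (ε⁻ x U u , v ∘ reify) , λ {y} (u′ , v′) → sub (ε y) (reify u′) (v′ ∘ ε⁻ y V)
    where open Priestley em ℓ priestleySpace

  -- By compactness every prime filter of clopen down-sets is the filter of some point. Order
  -- reflection by `ε` makes the chosen point unique up to `≈`, and `γ` inverts `ε`.
  γ : S.Point → Carrier
  γ y = proj₁ (realised (S.Point.isPrime y) λ {U} {V} → ⊆⇒≤ U V)

  γ⁻ : ∀ y U → U ∋ γ y → y S.∋ U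
  γ⁻ y U = proj₁ (proj₂ (realised (S.Point.isPrime y) λ {U} {V} → ⊆⇒≤ U V))

  γ⁺ : ∀ y U → y S.∋ U → U ∋ γ y
  γ⁺ y U = proj₂ (proj₂ (realised (S.Point.isPrime y) λ {U} {V} → ⊆⇒≤ U V))

  εγ≤ : ∀ y → ε (γ y) S.≤ᵖ y
  εγ≤ y U p = reify (γ⁺ y U p)

  ≤εγ : ∀ y → y S.≤ᵖ ε (γ y)
  ≤εγ y U p = γ⁻ y U (ε⁻ (γ y) U p)

  γ≤ : ∀ x y → x S.≤ᵖ ε y → γ x ≤ y
  γ≤ x y p = ε-reflects (γ x) y λ U u → εγ≤ x U (p U u)

  ≤γ : ∀ x y → ε x S.≤ᵖ y → x ≤ γ y
  ≤γ x y p = ε-reflects x (γ y) λ U u → p U (≤εγ y U u)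

  γε : ∀ x → γ (ε x) ≈ x
  γε x = antisym (γ≤ (ε x) x λ _ u → u) (≤γ x (ε x) λ _ u → u)

  εMap : ⊖-Map X (SpectrumSpace.space em ext ℓ (ClopenDownSets.algebra em ext ℓ X))
  εMap = record
    { ⟦_⟧        = ε
    ; continuous = ε-continuous
    ; mono       = λ {x} {y} → ε-mono x y
    ; i-homo     = λ x → ε-i≤ x , i≤ε-i x
    ; +-forth    = sum≤ε
    ; +-back     = λ x z q →
        let p  = ε-reflects (γ z) (i x) λ U u → εγ≤ z U (q U (i≤ε-i x U u))
            εp = λ U u → εγ≤ z U (q U u)
        in γ z , p , ≤εγ z ,
           (λ U u → ε≤sum x (γ z) p εp U
              (S.sum-mono (ε x) (ε x) (ε (γ z)) z εp q (λ _ v → v) (εγ≤ z) U u)) ,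
           (λ U u → S.sum-mono (ε x) (ε x) z (ε (γ z)) q εp (λ _ v → v) (≤εγ z) U
              (sum≤ε x (γ z) p εp U u))
    }

  γMap : ⊖-Map (SpectrumSpace.space em ext ℓ (ClopenDownSets.algebra em ext ℓ X)) X
  γMap = record
    { ⟦_⟧        = γ
    ; continuous = λ oU → lift λ y γy∈U →
        let (b , c , y∈b , y∉c , sub) = basis oU γy∈U in
        b , c , γ⁻ y b y∈b , y∉c ∘ γ⁺ y c , λ y′ p n → sub (γ y′) (γ⁺ y′ b p) (n ∘ γ⁻ y′ c)
    ; mono       = λ {x} {y} x≤y → γ≤ x (γ y) λ U u → x≤y U (≤εγ y U u)
    ; i-homo     = λ y → antisym
        (γ≤ (S.i y) (i (γ y)) λ U u → S.i-antitone (ε (γ y)) y (εγ≤ y) U (i≤ε-i (γ y) U u))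
        (≤γ (i (γ y)) (S.i y) λ U u → ε-i≤ (γ y) U (S.i-antitone y (ε (γ y)) (≤εγ y) U u))
    ; +-forth    = λ x y p q → ≤γ (γ x + γ y [ q ]) (S.sum x y p) λ U u →
        let r = εq x (γ y) q in
        ε≤sum (γ x) (γ y) q r U
          (S.sum-mono (ε (γ x)) x (ε (γ y)) y r p (εγ≤ x) (εγ≤ y) U u)
    ; +-back     = λ x z q →
        let r = εq x z q
            p = λ U u → r U (S.i-antitone x (ε (γ x)) (≤εγ x) U u)
        in ε z , p , ≤γ z (ε z) (λ _ u → u) , antisym
             (γ≤ (S.sum x (ε z) p) (γ x + z [ q ]) λ U u →
                           S.sum-mono x (ε (γ x)) (ε z) (ε z) p r (≤εγ x) (λ _ v → v) U
                           (sum≤ε (γ x) z q r U u))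
             (≤γ (γ x + z [ q ]) (S.sum x (ε z) p) λ U u → ε≤sum (γ x) z q r U
                           (S.sum-mono (ε (γ x)) x (ε z) (ε z) r p (εγ≤ x) (λ _ v → v) U u))
    }
    where
    εq : ∀ x z → z ≤ i (γ x) → ε z S.≤ᵖ S.i (ε (γ x))
    εq x z q U u = ε-mono z (i (γ x)) q U (ε-i≤ (γ x) U u)

-- The two functors and the natural isomorphisms.

module Functors (em : ∀ {a} → ExcludedMiddle a) (ext : ∀ {a b} → Extensionality a b) (ℓ : Level) where
  open Classical em ℓ
  open Category (⊖-Alg ℓ) using () renaming (_∘_ to _∘ᴬ_; id to idᴬ)
  open Category (⊖-Sp ℓ) using () renaming (_∘_ to _∘ˢ_; id to idˢ)
  private
    module P (A : ⊖-Algebra ℓ) = Spectrum em ext ℓ A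
    module K (X : ⊖-Space ℓ) = ClopenDownSets em ext ℓ X
    module Co {A B : ⊖-Algebra ℓ} (h : ⊖-Hom A B) = Comap em ext ℓ h
    module Pre {X Y : ⊖-Space ℓ} (f : ⊖-Map X Y) = Preimage em ext ℓ f
    module AU (A : ⊖-Algebra ℓ) = AlgebraUnit em ext ℓ A
    module SU (X : ⊖-Space ℓ) = SpaceUnit em ext ℓ X

  spectrum : Functor (op (⊖-Alg ℓ)) (⊖-Sp ℓ)
  spectrum = record
    { F₀           = SpectrumSpace.space em ext ℓ
    ; F₁           = Co.comapMap
    ; F-resp-≈     = λ {A} {_} {f} {g} f≈g x →
        (λ b p → reify (P.Point.resp A x (⊖-Algebra.sym A (f≈g b)) (Co.comap⁻ g x p))) ,
        (λ b p → reify (P.Point.resp A x (f≈g b) (Co.comap⁻ f x p)))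
    ; identity     = λ {A} x → (λ _ p → reify p) , (λ _ p → Co.comap⁻ (idᴬ {A}) x p)
    ; homomorphism = λ {_} {_} {_} {f} {g} x →
        (λ _ p → reify (Co.comap⁻ f x (Co.comap⁻ g (Co.comap f x) p))) ,
        (λ _ p → reify (reify (Co.comap⁻ (f ∘ᴬ g) x p)))
    }

  clopenDownSets : Functor (⊖-Sp ℓ) (op (⊖-Alg ℓ))
  clopenDownSets = record
    { F₀           = ClopenDownSets.algebra em ext ℓ
    ; F₁           = Pre.hom
    ; F-resp-≈     = λ {_} {Y} {f} {g} f≈g U → let open ⊖-Space Y using (reflexive; module Eq) in
        (λ {x} p → reify (K.down Y U (reflexive (Eq.sym (f≈g x))) (Pre.preimage⁻ f U p))) ,
        (λ {x} p → reify (K.down Y U (reflexive (f≈g x)) (Pre.preimage⁻ g U p)))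
    ; identity     = λ {X} U → Pre.preimage⁻ (idˢ {X}) U , reify
    ; homomorphism = λ {_} {_} {_} {f} {g} U →
        (λ p → reify (reify (Pre.preimage⁻ (g ∘ˢ f) U p))) ,
        (λ p → reify (Pre.preimage⁻ g U (Pre.preimage⁻ f (Pre.preimage g U) p)))
    }

  basic-natural : ∀ {A B} (f : ⊖-Hom B A) b →
    ⊖-Algebra._≈_ (ClopenDownSets.algebra em ext ℓ (SpectrumSpace.space em ext ℓ A))
      (Pre.preimage (Co.comapMap f) (AU.basic B b)) (AU.basic A (⊖-Hom.⟦ f ⟧ b))
  basic-natural {A} {B} f b =
        (λ {x} p → reify (Co.comap⁻ f x (AU.basic⁻ B b {Co.comap f x}
                     (Pre.preimage⁻ (Co.comapMap f) (AU.basic B b) {x} p)))) ,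
        (λ {x} p → reify (reify (reify (AU.basic⁻ A (⊖-Hom.⟦ f ⟧ b) {x} p))))

  algebraUnit : NaturalIsomorphism (clopenDownSets ∘F spectrum) (idF (op (⊖-Alg ℓ)))
  algebraUnit = record
    -- In the opposite category the arrow from the double dual to `A` is the homomorphism out of
    -- `A`. Hence `isoˡ` is the surjectivity equation and `isoʳ` follows from injectivity.
    { η       = AU.hom
    ; η⁻¹     = η⁻¹
    ; isoˡ    = λ A U → proj₂ (AU.surjective A U)
    ; isoʳ    = λ A a → AU.injective A (⊖-Hom.⟦ η⁻¹ A ⟧ (AU.basic A a)) a
                  (proj₂ (AU.surjective A (AU.basic A a)))
    ; natural = λ f → basic-natural f
    }
    where
    η⁻¹ : ∀ A → ⊖-Hom (ClopenDownSets.algebra em ext ℓ (SpectrumSpace.space em ext ℓ A)) A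
    η⁻¹ A = inverseHom (AU.hom A) (AU.injective A) (AU.surjective A)

  spaceUnit : NaturalIsomorphism (spectrum ∘F clopenDownSets) (idF (⊖-Sp ℓ))
  spaceUnit = record
    { η       = SU.γMap
    ; η⁻¹     = SU.εMap
    ; isoˡ    = λ X y → SU.εγ≤ X y , SU.≤εγ X y
    ; isoʳ    = SU.γε
    ; natural = λ {X} {Y} f y →
        let fy = Co.comap (Pre.hom f) y in
        ⊖-Space.antisym Y
          (SU.γ≤ Y fy (⊖-Map.⟦ f ⟧ (SU.γ X y)) λ U u →
            reify (SU.γ⁻ X y (Pre.preimage f U) (reify (SU.ε⁻ Y (⊖-Map.⟦ f ⟧ (SU.γ X y)) U u))))
          (SU.≤γ Y (⊖-Map.⟦ f ⟧ (SU.γ X y)) fy λ U u →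
            reify (Pre.preimage⁻ f U (SU.γ⁺ X y (Pre.preimage f U) (Co.comap⁻ (Pre.hom f) y u))))
    }

theorem3p27 : (∀ {a} → ExcludedMiddle a) → (∀ {a b} → Extensionality a b) →
    (ℓ : Level) → DualEquivalence (⊖-Alg ℓ) (⊖-Sp ℓ)
theorem3p27 em ext ℓ = record
  { F    = spectrum
  ; G    = clopenDownSets
  ; GF≅1 = algebraUnit
  ; FG≅1 = spaceUnit
  }
  where open Functors em ext ℓ
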